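{- Let $n\ge 2$ and $m\ge 2$ be integers. The number of tame friezes of width $m$ over the ring $\mathbb{Z}/n\mathbb{Z}$ is \[ \prod_{p\mid n}\frac{p^{(\nu_p(n)-1)(m-1)}\,\bigl(p^{m-1}+(-1)^m\bigr)(p-1)}{p+1}, \] where the product runs over the prime divisors $p$ of $n$.
   Context: For a prime $p$, $\nu_p(n)$ denotes the exponent of $p$ in the prime factorisation of $n$. Let $R=\mathbb{Z}/n\mathbb{Z}$. A frieze of width $m$ over $R$ is a family of entries $E(u,v)\in R$ indexed by all pairs of integers $(u,v)$ with $0\le v-u\le m$ (visualised as an array of $m+1$ bi-infinite rows offset alternately, the entry $E(u,v)$ lying in row $v-u$), such that $E(u,u)=E(u,u+m)=0$ for all $u\in\mathbb{Z}$ (the first and last rows are zero), and every diamond of four contiguous entries satisfies the unimodular rule: for all integers $u,v$ with $1\le v-u\le m-1$, \[ E(u,v)E(u+1,v+1)-E(u+1,v)E(u,v+1)=1 \text{ in } R. \] The frieze is tame if every diamond of nine contiguous entries has determinant zero: for all integers $u,v$ with $2\le v-u\le m-2$, the $3\times3$ determinant $\det\bigl(E(u+i,v+j)\bigr)_{i,j=0,1,2}$ equals $0$ in $R$. Friezes are counted as families of entries (two friezes are the same iff all entries agree). -}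

module Defs where

open import Data.Nat as ℕ using (ℕ; zero; suc; _<?_)
open import Data.Nat.Divisibility using (_∣_; _∣?_; divides)
open import Data.Nat.Primality using (Prime; prime?)
open import Data.Integer as ℤ using (ℤ; +_; -[1+_]; _-_; _*_; _+_; ∣_∣; _≤_)
open import Data.Fin using (Fin; toℕ; fromℕ<)
open import Data.List using (List; filter; upTo; foldr)
open import Relation.Nullary using (yes; no)
open import Relation.Nullary.Decidable using (_×-dec_)
open import Relation.Binary.PropositionalEquality using (_≡_)

infix 4 _≅_[mod_]
_≅_[mod_] : ℤ → ℤ → ℕ → Set
a ≅ b [mod n ] = n ∣ ∣ a - b ∣

-- A family of entries of a frieze of width m over ℤ/nℤ:
-- F u i is the entry E(u, u+i), for 0 ≤ i ≤ m; residues are represented by Fin n.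
Entries : ℕ → ℕ → Set
Entries n m = ℤ → Fin (suc m) → Fin n

-- E(u,v) as an integer representative (meaningful only when 0 ≤ v - u ≤ m;
-- the default value 0 is never used for such pairs).
entry : ∀ {n m} → Entries n m → ℤ → ℤ → ℤ
entry {n} {m} F u v with v - u
... | -[1+ _ ] = + 0
... | + k with k <? suc m
...   | yes k<  = + toℕ (F u (fromℕ< k<))
...   | no _    = + 0

det3 : ℤ → ℤ → ℤ → ℤ → ℤ → ℤ → ℤ → ℤ → ℤ → ℤ
det3 a b c d e f g h i =
  a * (e * i - f * h) - b * (d * i - f * g) + c * (d * h - e * g)

record TameFrieze (n m : ℕ) : Set where
  field
    E : Entries n m
    firstRow : ∀ u → entry E u u ≡ + 0
    lastRow  : ∀ u → entry E u (u + + m) ≡ + 0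
    unimodular : ∀ u v → + 1 ≤ v - u → v - u ≤ + (m ℕ.∸ 1) →
      entry E u v * entry E (u + + 1) (v + + 1)
        - entry E (u + + 1) v * entry E u (v + + 1) ≅ + 1 [mod n ]
    tame : ∀ u v → + 2 ≤ v - u → v - u ≤ + (m ℕ.∸ 2) →
      det3 (entry E u v)       (entry E u (v + + 1))       (entry E u (v + + 2))
           (entry E (u + + 1) v) (entry E (u + + 1) (v + + 1)) (entry E (u + + 1) (v + + 2))
           (entry E (u + + 2) v) (entry E (u + + 2) (v + + 1)) (entry E (u + + 2) (v + + 2))
        ≅ + 0 [mod n ]

_≈F_ : ∀ {n m} → TameFrieze n m → TameFrieze n m → Set
F ≈F G = ∀ u i → TameFrieze.E F u i ≡ TameFrieze.E G u i

record HasCardinality (A : Set) (_≈_ : A → A → Set) (N : ℕ) : Set where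
  field
    to      : A → Fin N
    from    : Fin N → A
    to-cong : ∀ {a b} → a ≈ b → to a ≡ to b
    from-to : ∀ a → from (to a) ≈ a
    to-from : ∀ i → to (from i) ≡ i

-- p-adic valuation ν_p(n) (fuel-based; fuel n suffices for n ≥ 1, p ≥ 2)
νaux : ℕ → ℕ → ℕ → ℕ
νaux zero    p n = 0
νaux (suc f) p zero = 0
νaux (suc f) p (suc n) with p ∣? suc n
... | yes (divides q _) = suc (νaux f p q)
... | no _ = 0

ν : ℕ → ℕ → ℕ
ν p n = νaux n p n

primeDivisors : ℕ → List ℕ
primeDivisors n = filter (λ p → prime? p ×-dec (p ∣? n)) (upTo (suc n))

prodℤ : List ℤ → ℤ
prodℤ = foldr _*_ (+ 1)

numFactor : ℕ → ℕ → ℕ → ℤ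
numFactor n m p =
  (+ p) ℤ.^ ((ν p n ℕ.∸ 1) ℕ.* (m ℕ.∸ 1))
    * ((+ p) ℤ.^ (m ℕ.∸ 1) + (ℤ.- (+ 1)) ℤ.^ m)
    * (+ p - + 1)

denFactor : ℕ → ℤ
denFactor p = + p + + 1

-- Two consecutive rows p, q of a frieze form a sequence of vectors (pᵢ, qᵢ₋₁) whose consecutive
-- determinants are 1. Tameness says exactly that every further row is the combination d·q − p of
-- the two before it, where d is forced by the border of zeros; this step is invertible, so a tame
-- frieze is the same thing as one pair of adjacent rows. Such a pair is generated by the recurrence
-- wᵢ₊₂ = cᵢ wᵢ₊₁ − wᵢ from a unit e and coefficients c₀, …, cₘ₋₃, the only condition being that the
-- last value of the first coordinate is a unit. Whether it is a unit is decided modulo each prime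
-- p ∣ n. There, from a state with a nonzero current value exactly one coefficient leads to zero,
-- and from zero every coefficient leads to a nonzero value; the Chinese remainder theorem, applied
-- to the sum over one coefficient at a time, makes the count multiplicative.

module Submission where

open import Defs
open import Data.Bool using (if_then_else_; true; false)
open import Data.Fin as Fin using (Fin; toℕ; fromℕ<)
open import Data.Fin.Permutation using (permutation)
import Data.Fin.Properties as Fin
open import Data.Integer as ℤ using (ℤ; +_; -[1+_]; _-_; _*_; _+_; ∣_∣; -_; _%ℕ_; _/ℕ_; +≤+)
import Data.Integer.Divisibility.Signed as Signed
open import Data.Integer.DivMod using (n%ℕd<d; a≡a%ℕn+[a/ℕn]*n)
import Data.Integer.Properties as ℤ
open import Data.Integer.Tactic.RingSolver using (solve-∀)
open import Data.List as List using (List; []; _∷_; map; filter; allFin; tabulate; cartesianProductWith; length; lookup)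
import Data.List.Properties as List
open import Data.List.Membership.Propositional using (_∈_)
open import Data.List.Membership.Propositional.Properties using (∈-cartesianProductWith⁺; ∈-allFin; ∈-filter⁺; ∈-filter⁻; ∈-lookup; ∈-upTo⁺; ∈-map⁺)
open import Data.List.Membership.Propositional.Properties.WithK using (unique⇒irrelevant)
open import Data.List.Relation.Unary.All as All using (All; []; _∷_)
open import Data.List.Relation.Unary.AllPairs using ([]; _∷_)
open import Data.List.Relation.Unary.Any using (here; there; index)
open import Data.List.Relation.Unary.Any.Properties using (lookup-index)
open import Data.List.Relation.Unary.Unique.Propositional using (Unique)
import Data.List.Relation.Unary.Unique.Propositional.Properties as Unique
open import Data.Nat as ℕ using (ℕ; zero; suc; z≤n; s≤s; NonZero; _∸_; _^_; _≤_; _<?_)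
open import Data.Nat.Coprimality as Coprime using (Coprime; coprime-Bézout; coprime-divisor)
open import Data.Nat.Divisibility as ∣ using (_∣_; divides; ∣⇒≤; _∣?_)
import Data.Nat.DivMod as ℕ
open import Data.Nat.GCD using (module Bézout; gcd; gcd[m,n]∣m; gcd[m,n]∣n; gcd[m,n]≢0)
open import Data.Nat.ListAction using (sum; product)
open import Data.Nat.ListAction.Properties using (∈⇒∣product; sum-++)
open import Data.Nat.Primality using (Prime; prime?; euclidsLemma; prime⇒irreducible; prime⇒nonZero; prime⇒nonTrivial; productOfPrimes≢0)
open import Data.Nat.Primality.Factorisation using (factorisationHasAllPrimeFactors; factorise)
import Data.Nat.Properties as ℕ
import Data.Nat.Tactic.RingSolver as ℕ-solver
open import Data.Product using (Σ; ∃; _×_; _,_; proj₁; proj₂)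
open import Data.Sum using (inj₁; inj₂)
open import Data.Vec using (Vec; []; _∷_)
open import Function as Function using (_∘_)
open import Relation.Binary.Definitions using (tri<; tri≈; tri>)
open import Relation.Binary.PropositionalEquality using (_≡_; refl; sym; trans; cong; cong₂; subst; subst₂; module ≡-Reasoning)
open import Relation.Nullary using (Dec; yes; no; contradiction; ¬_; does)
open import Relation.Nullary.Decidable using (map′; _×-dec_; dec-true; dec-false)
open import Relation.Unary using (Decidable)
import Algebra.Properties.CommutativeMonoid.Sum ℕ.+-0-commutativeMonoid as Sum

-- Over ℤ/n the inner entries of a frieze may be zero or zero divisors, so a row cannot be continued
-- by dividing by its entries. Only the entries next to the border are known to be units; the factor
-- d and the values that close a row are obtained from them. The coefficients of the recurrence are
-- likewise read off without division, as determinants of columns two apart. The factor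
-- p^((ν-1)(m-1)) has this origin: whether a value is a unit depends only on its residue modulo the
-- radical of n. Each of the m - 1 choices (the starting unit and m - 2 coefficients) therefore
-- contributes the factor n / rad n, which is the product of the p^(ν-1). Modulo p the starting unit
-- contributes p - 1, and the coefficients contribute the solution of a two-state linear recurrence,
-- whence the denominator p + 1. Vectors over ℤ/n are never split into vectors over the prime
-- fields. The indicator of a unit is a product over p of functions of period p, and summing out one
-- coefficient preserves this shape, as long as the previous and the current value do not both
-- vanish modulo p; the recurrence preserves that condition.

module Modular (n : ℕ) where

  infix 4 _≈_

  -- The explicit quotient, in place of divisibility of an absolute value, turns a congruence into
  -- an integer identity that can be scaled and added.
  record _≈_ (a b : ℤ) : Set where
    constructor congruent
    field
      quot     : ℤ
      equation : a - b ≡ quot * + n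

  ≅⇒≈ : ∀ {a b} → a ≅ b [mod n ] → a ≈ b
  ≅⇒≈ {a} {b} d with Signed.∣ᵤ⇒∣ {+ n} {a - b} d
  ... | Signed.divides q eq = congruent q eq

  ≈⇒≅ : ∀ {a b} → a ≈ b → a ≅ b [mod n ]
  ≈⇒≅ {a} {b} (congruent q eq) = Signed.∣⇒∣ᵤ {+ n} {a - b} (Signed.divides q eq)

  ≈-reflexive : ∀ {a b} → a ≡ b → a ≈ b
  ≈-reflexive {a} refl = congruent (+ 0) (ℤ.+-inverseʳ a)

  ≈-refl : ∀ {a} → a ≈ a
  ≈-refl = ≈-reflexive refl

  -- The workhorse for congruences, with its variants for two and three hypotheses: the difference
  -- of the two sides is exhibited as an integer combination of the differences in the hypotheses,
  -- and the ring solver checks that identity.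
  lincomb₁ : ∀ {x y a b} s → a ≈ b → x - y ≡ s * (a - b) → x ≈ y
  lincomb₁ s (congruent q e) id =
    congruent (s * q) (trans id (trans (cong (s *_) e) (sym (ℤ.*-assoc s q (+ n)))))

  lincomb₂ : ∀ {x y a b c d} s t → a ≈ b → c ≈ d →
             x - y ≡ s * (a - b) + t * (c - d) → x ≈ y
  lincomb₂ s t (congruent q e) (congruent r f) id =
    congruent (s * q + t * r)
      (trans id (trans (cong₂ (λ v w → s * v + t * w) e f) (distr s q t r (+ n))))
    where
    distr : ∀ s q t r n → s * (q * n) + t * (r * n) ≡ (s * q + t * r) * n
    distr = solve-∀

  lincomb₃ : ∀ {x y a b c d e f} s t u → a ≈ b → c ≈ d → e ≈ f →
             x - y ≡ s * (a - b) + t * (c - d) + u * (e - f) → x ≈ y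
  lincomb₃ {a = a} {b} {c} {d} {e} {f} s t u p q r id =
    lincomb₂ s (+ 1) p (lincomb₂ {x = t * (c - d) + u * (e - f)} {y = + 0} t u q r (drop _))
      (trans id (regroup (s * (a - b)) (t * (c - d)) (u * (e - f))))
    where
    drop : ∀ x → x - + 0 ≡ x
    drop = solve-∀
    regroup : ∀ x y z → x + y + z ≡ x + + 1 * (y + z - + 0)
    regroup = solve-∀

  ≈-sym : ∀ {a b} → a ≈ b → b ≈ a
  ≈-sym {a} {b} p = lincomb₁ (- + 1) p (id a b)
    where
    id : ∀ a b → b - a ≡ (- + 1) * (a - b)
    id = solve-∀

  ≈-trans : ∀ {a b c} → a ≈ b → b ≈ c → a ≈ c
  ≈-trans {a} {b} {c} p q = lincomb₂ (+ 1) (+ 1) p q (id a b c)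
    where
    id : ∀ a b c → a - c ≡ + 1 * (a - b) + + 1 * (b - c)
    id = solve-∀

  *-cong : ∀ {a b c d} → a ≈ b → c ≈ d → a * c ≈ b * d
  *-cong {a} {b} {c} {d} p q = lincomb₂ c b p q (id a b c d)
    where
    id : ∀ a b c d → a * c - b * d ≡ c * (a - b) + b * (c - d)
    id = solve-∀

  -‿cong : ∀ {a b c d} → a ≈ b → c ≈ d → a - c ≈ b - d
  -‿cong {a} {b} {c} {d} p q = lincomb₂ (+ 1) (- + 1) p q (id a b c d)
    where
    id : ∀ a b c d → (a - c) - (b - d) ≡ + 1 * (a - b) + (- + 1) * (c - d)
    id = solve-∀

  inverse-sym : ∀ a b → a * b ≈ + 1 → b * a ≈ + 1
  inverse-sym a b p = ≈-trans (≈-reflexive (ℤ.*-comm b a)) p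

  inverse-unique : ∀ {a b c} → a * c ≈ + 1 → b * c ≈ + 1 → a ≈ b
  inverse-unique {a} {b} {c} p q = lincomb₂ b (- a) p q (id a b c)
    where
    id : ∀ a b c → a - b ≡ b * (a * c - + 1) + (- a) * (b * c - + 1)
    id = solve-∀

  infix 4 _≈?_

  _≈?_ : ∀ a b → Dec (a ≈ b)
  a ≈? b = map′ ≅⇒≈ ≈⇒≅ (n ∣? ∣ a - b ∣)

  ⟦_⟧ : Fin n → ℤ
  ⟦ i ⟧ = + toℕ i

  module Residue .{{_ : NonZero n}} where

    residue : ℤ → Fin n
    residue a = fromℕ< (n%ℕd<d a n)

    ⟦residue⟧ : ∀ a → ⟦ residue a ⟧ ≈ a
    ⟦residue⟧ a = congruent (- (a /ℕ n))
      (trans (cong (λ r → + r - a) (Fin.toℕ-fromℕ< (n%ℕd<d a n)))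
        (trans (cong (λ b → + (a %ℕ n) - b) (a≡a%ℕn+[a/ℕn]*n a n)) (id (+ (a %ℕ n)) (a /ℕ n) (+ n))))
      where
      id : ∀ r q n → r - (r + q * n) ≡ (- q) * n
      id = solve-∀

    ⟦⟧-injective : ∀ {i j} → ⟦ i ⟧ ≈ ⟦ j ⟧ → i ≡ j
    ⟦⟧-injective {i} {j} p = Fin.toℕ-injective (ℕ.≤-antisym (leq i j (≈⇒≅ p)) (leq j i (≈⇒≅ (≈-sym p))))
      where
      leq : ∀ i j → ⟦ i ⟧ ≅ ⟦ j ⟧ [mod n ] → toℕ i ℕ.≤ toℕ j
      leq i j d with ℕ.≤-total (toℕ i) (toℕ j)
      ... | inj₁ i≤j = i≤j
      ... | inj₂ j≤i with toℕ i ℕ.∸ toℕ j in eq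
      ... | zero  = ℕ.m∸n≡0⇒m≤n eq
      ... | suc w = contradiction (ℕ.≤-trans (∣⇒≤ n∣w) w≤i) (ℕ.<⇒≱ (Fin.toℕ<n i))
        where
        n∣w : n ∣ suc w
        n∣w = subst (n ∣_) (trans (cong ∣_∣ (trans (ℤ.m-n≡m⊖n (toℕ i) (toℕ j)) (ℤ.⊖-≥ j≤i))) eq) d
        w≤i : suc w ℕ.≤ toℕ i
        w≤i = subst (ℕ._≤ toℕ i) eq (ℕ.m∸n≤m (toℕ i) (toℕ j))

    residue-cong : ∀ {a b} → a ≈ b → residue a ≡ residue b
    residue-cong p = ⟦⟧-injective (≈-trans (⟦residue⟧ _) (≈-trans p (≈-sym (⟦residue⟧ _))))

    residue-⟦⟧ : ∀ i → residue ⟦ i ⟧ ≡ i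
    residue-⟦⟧ i = ⟦⟧-injective (⟦residue⟧ _)

-- Rows of a tame frieze

Row : Set
Row = ℕ → ℤ

module Rows (n k : ℕ) where
  open Modular n

  infix 4 _~_

  -- Only these indices belong to a row of width k + 2; the values of a `Row` further out are
  -- arbitrary.
  _~_ : Row → Row → Set
  r ~ s = ∀ i → i ℕ.≤ 2 ℕ.+ k → r i ≈ s i

  ~-trans : ∀ {r s t} → r ~ s → s ~ t → r ~ t
  ~-trans p q i i≤ = ≈-trans (p i i≤) (q i i≤)

  ~-sym : ∀ {r s} → r ~ s → s ~ r
  ~-sym p i i≤ = ≈-sym (p i i≤)

  -- The width is m = k + 2, and p j = E(u, u + j), q j = E(u + 1, u + 1 + j): both rows are
  -- indexed by their distance from the first row of zeros.
  record Adjacent (p q : Row) : Set where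
    field
      p-first : p 0 ≈ + 0
      p-last  : p (2 ℕ.+ k) ≈ + 0
      q-first : q 0 ≈ + 0
      q-last  : q (2 ℕ.+ k) ≈ + 0
      diamond : ∀ j → j ℕ.≤ k → p (1 ℕ.+ j) * q (1 ℕ.+ j) - q j * p (2 ℕ.+ j) ≈ + 1

    -- At either end the border of zeros kills the subtracted product of a diamond. This is the only
    -- source of invertible entries.
    first-inverse : p 1 * q 1 ≈ + 1
    first-inverse = lincomb₂ (+ 1) (p 2) (diamond 0 z≤n) q-first (id (p 1) (q 1) (q 0) (p 2))
      where
      id : ∀ a b c d → a * b - + 1 ≡ + 1 * (a * b - c * d - + 1) + d * (c - + 0)
      id = solve-∀

    last-inverse : p (suc k) * q (suc k) ≈ + 1
    last-inverse = lincomb₂ (+ 1) (q k) (diamond k ℕ.≤-refl) p-last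
      (id (p (suc k)) (q (suc k)) (q k) (p (2 ℕ.+ k)))
      where
      id : ∀ a b c d → a * b - + 1 ≡ + 1 * (a * b - c * d - + 1) + c * (d - + 0)
      id = solve-∀

  open Adjacent

  Adjacent-resp : ∀ {p p′ q q′} → p ~ p′ → q ~ q′ → Adjacent p q → Adjacent p′ q′
  Adjacent-resp pp qq a = record
    { p-first = ≈-trans (≈-sym (pp 0 z≤n)) (p-first a)
    ; p-last  = ≈-trans (≈-sym (pp (2 ℕ.+ k) ℕ.≤-refl)) (p-last a)
    ; q-first = ≈-trans (≈-sym (qq 0 z≤n)) (q-first a)
    ; q-last  = ≈-trans (≈-sym (qq (2 ℕ.+ k) ℕ.≤-refl)) (q-last a)
    ; diamond = λ j j≤k → ≈-trans
        (≈-sym (-‿cong (*-cong (pp (suc j) (s≤s (ℕ.m≤n⇒m≤1+n j≤k))) (qq (suc j) (s≤s (ℕ.m≤n⇒m≤1+n j≤k))))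
                       (*-cong (qq j (ℕ.m≤n⇒m≤o+n 2 j≤k)) (pp (2 ℕ.+ j) (s≤s (s≤s j≤k))))))
        (diamond a j j≤k)
    }

  -- E(u + 2, v) = d E(u + 1, v) − E(u, v), where d = p 2 * p 1 makes E(u + 2, u + 2) vanish. The
  -- entry at k + 1 lies outside the range of E(u, _); it is the inverse of q (k + 1), as is p (k + 1).
  next : Row → Row → Row
  next p q i with ℕ.<-cmp i (suc k)
  ... | tri< _ _ _ = p 2 * p 1 * q (suc i) - p (2 ℕ.+ i)
  ... | tri≈ _ _ _ = p (suc k)
  ... | tri> _ _ _ = + 0

  next-inner : ∀ p q i → i ℕ.≤ k → next p q i ≡ p 2 * p 1 * q (suc i) - p (2 ℕ.+ i)
  next-inner p q i i≤k with ℕ.<-cmp i (suc k)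
  ... | tri< _ _ _  = refl
  ... | tri≈ i≮ _ _ = contradiction (s≤s i≤k) i≮
  ... | tri> i≮ _ _ = contradiction (s≤s i≤k) i≮

  next-penultimate : ∀ p q → next p q (suc k) ≡ p (suc k)
  next-penultimate p q with ℕ.<-cmp (suc k) (suc k)
  ... | tri< _ ≢ _ = contradiction refl ≢
  ... | tri≈ _ _ _ = refl
  ... | tri> _ ≢ _ = contradiction refl ≢

  next-last : ∀ p q → next p q (2 ℕ.+ k) ≡ + 0
  next-last p q with ℕ.<-cmp (2 ℕ.+ k) (suc k)
  ... | tri< _ _ > = contradiction ℕ.≤-refl >
  ... | tri≈ _ _ > = contradiction ℕ.≤-refl >
  ... | tri> _ _ _ = refl

  -- The inverse step p (i + 2) = d q (i + 1) - t i. The zero at the far end of p forces d = t k * t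
  -- (k + 1), because t (k + 1) inverts q (k + 1). The entry at 1 lies outside this formula; both it
  -- and t 1 must invert q 1.
  prev : Row → Row → Row
  prev q t 0             = + 0
  prev q t 1             = t 1
  prev q t (suc (suc i)) = t k * t (suc k) * q (suc i) - t i

  by-position : (P : ℕ → Set) → (∀ i → i ℕ.≤ k → P i) → P (suc k) → P (2 ℕ.+ k) →
                ∀ i → i ℕ.≤ 2 ℕ.+ k → P i
  by-position P inner pen last i i≤ with ℕ.m≤n⇒m<n∨m≡n i≤
  ... | inj₂ refl = last
  ... | inj₁ (s≤s i≤1+k) with ℕ.m≤n⇒m<n∨m≡n i≤1+k
  ...   | inj₂ refl = pen
  ...   | inj₁ (s≤s i≤k) = inner i i≤k

  -- Passing from (p, q) to (q, d q - p) has determinant 1, so diamond j of the new pair equals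
  -- diamond j + 1 of the old one. At j = k that index runs out; there the penultimate entry, chosen
  -- as an inverse of q (k + 1), makes the diamond 1.
  next-adjacent : ∀ {p q} → Adjacent p q → Adjacent q (next p q)
  next-adjacent {p} {q} a = record
    { p-first = q-first a
    ; p-last  = q-last a
    ; q-first = ≈-trans (≈-reflexive (next-inner p q 0 z≤n))
                  (lincomb₁ (p 2) (first-inverse a) (id₀ (p 1) (p 2) (q 1)))
    ; q-last  = ≈-reflexive (next-last p q)
    ; diamond = dia
    }
    where
    id₀ : ∀ p₁ p₂ q₁ → p₂ * p₁ * q₁ - p₂ - + 0 ≡ p₂ * (p₁ * q₁ - + 1)
    id₀ = solve-∀
    id₁ : ∀ d q₁ q₂ p₂ p₃ → q₁ * (d * q₂ - p₃) - (d * q₁ - p₂) * q₂ - + 1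
                          ≡ + 1 * (p₂ * q₂ - q₁ * p₃ - + 1)
    id₁ = solve-∀
    id₂ : ∀ p₁ q₁ t q₂ → q₁ * p₁ - t * q₂ - + 1 ≡ + 1 * (p₁ * q₁ - + 1) + (- t) * (q₂ - + 0)
    id₂ = solve-∀
    dia : ∀ j → j ℕ.≤ k → q (1 ℕ.+ j) * next p q (1 ℕ.+ j) - next p q j * q (2 ℕ.+ j) ≈ + 1
    dia j j≤k with ℕ.m≤n⇒m<n∨m≡n j≤k
    ... | inj₁ j<k rewrite next-inner p q j j≤k | next-inner p q (suc j) j<k =
      lincomb₁ (+ 1) (diamond a (suc j) j<k)
        (id₁ (p 2 * p 1) (q (suc j)) (q (2 ℕ.+ j)) (p (2 ℕ.+ j)) (p (3 ℕ.+ j)))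
    ... | inj₂ refl rewrite next-penultimate p q =
      lincomb₂ (+ 1) (- next p q k) (last-inverse a) (q-last a)
        (id₂ (p (suc k)) (q (suc k)) (next p q k) (q (2 ℕ.+ k)))

  prev-adjacent : ∀ {q t} → Adjacent q t → Adjacent (prev q t) q
  prev-adjacent {q} {t} a = record
    { p-first = ≈-refl
    ; p-last  = lincomb₁ (t k) (last-inverse a) (id₀ (t k) (t (suc k)) (q (suc k)))
    ; q-first = p-first a
    ; q-last  = p-last a
    ; diamond = dia
    }
    where
    id₀ : ∀ t₀ t₁ q₁ → t₀ * t₁ * q₁ - t₀ - + 0 ≡ t₀ * (q₁ * t₁ - + 1)
    id₀ = solve-∀
    id₁ : ∀ q₁ t₁ q₀ p₂ → t₁ * q₁ - q₀ * p₂ - + 1 ≡ + 1 * (q₁ * t₁ - + 1) + (- p₂) * (q₀ - + 0)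
    id₁ = solve-∀
    id₂ : ∀ d q₁ q₂ t₀ t₁ → (d * q₁ - t₀) * q₂ - q₁ * (d * q₂ - t₁) - + 1
                          ≡ + 1 * (q₁ * t₁ - t₀ * q₂ - + 1)
    id₂ = solve-∀
    dia : ∀ j → j ℕ.≤ k → prev q t (1 ℕ.+ j) * q (1 ℕ.+ j) - q j * prev q t (2 ℕ.+ j) ≈ + 1
    dia zero    _   = lincomb₂ (+ 1) (- prev q t 2) (first-inverse a) (p-first a)
                        (id₁ (q 1) (t 1) (q 0) (prev q t 2))
    dia (suc j) j<k = lincomb₁ (+ 1) (diamond a j (ℕ.<⇒≤ j<k))
                        (id₂ (t k * t (suc k)) (q (suc j)) (q (2 ℕ.+ j)) (t j) (t (suc j)))

  -- The two formulas for d agree: p 2 * p 1 = (d q 1 - t 0) t 1 collapses to d, because q 1 t 1 = 1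
  -- and t 0 = 0.
  next-prev : ∀ {q t} → Adjacent q t → next (prev q t) q ~ t
  next-prev {q} {t} a = by-position _ inner pen last
    where
    p = prev q t
    a′ = prev-adjacent a
    id : ∀ d q₁ t₀ t₁ q′ t′ →
         (d * q₁ - t₀) * t₁ * q′ - (d * q′ - t′) - t′ ≡ d * q′ * (q₁ * t₁ - + 1) + (- (t₁ * q′)) * (t₀ - + 0)
    id = solve-∀
    inner : ∀ i → i ℕ.≤ k → next p q i ≈ t i
    inner i i≤k = ≈-trans (≈-reflexive (next-inner p q i i≤k))
      (lincomb₂ (t k * t (suc k) * q (suc i)) (- (t 1 * q (suc i))) (first-inverse a) (q-first a)
        (id (t k * t (suc k)) (q 1) (t 0) (t 1) (q (suc i)) (t i)))
    pen : next p q (suc k) ≈ t (suc k)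
    pen = ≈-trans (≈-reflexive (next-penultimate p q))
      (inverse-unique (last-inverse a′) (inverse-sym (q (suc k)) (t (suc k)) (last-inverse a)))
    last : next p q (2 ℕ.+ k) ≈ t (2 ℕ.+ k)
    last = ≈-trans (≈-reflexive (next-last p q)) (≈-sym (q-last a))

  prev-next : ∀ {p q} → Adjacent p q → prev q (next p q) ~ p
  prev-next {p} {q} a = go
    where
    t = next p q
    a′ = next-adjacent a
    id : ∀ d p₁ q₁ p₂ q′ p′ →
         (d * q₁ - p₂) * p₁ * q′ - (d * q′ - p′) - p′ ≡ d * q′ * (p₁ * q₁ - + 1) + (- (p₁ * q′)) * (p₂ - + 0)
    id = solve-∀
    go : ∀ i → i ℕ.≤ 2 ℕ.+ k → prev q t i ≈ p i
    go 0 _ = ≈-sym (p-first a)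
    go 1 _ = inverse-unique (inverse-sym (q 1) (t 1) (first-inverse a′)) (first-inverse a)
    go (suc (suc i)) (s≤s (s≤s i≤k))
      rewrite next-inner p q i i≤k | next-inner p q k ℕ.≤-refl | next-penultimate p q =
      lincomb₂ (p 2 * p 1 * q (suc i)) (- (p (suc k) * q (suc i))) (last-inverse a) (p-last a)
        (id (p 2 * p 1) (p (suc k)) (q (suc k)) (p (2 ℕ.+ k)) (q (suc i)) (p (2 ℕ.+ i)))

  next-cong : ∀ {p p′ q q′} → p ~ p′ → q ~ q′ → next p q ~ next p′ q′
  next-cong {p} {p′} {q} {q′} pp qq = by-position _ inner pen last
    where
    inner : ∀ i → i ℕ.≤ k → next p q i ≈ next p′ q′ i
    inner i i≤k rewrite next-inner p q i i≤k | next-inner p′ q′ i i≤k =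
      -‿cong (*-cong (*-cong (pp 2 (s≤s (s≤s z≤n))) (pp 1 (s≤s z≤n))) (qq (suc i) (s≤s (ℕ.m≤n⇒m≤1+n i≤k))))
             (pp (2 ℕ.+ i) (s≤s (s≤s i≤k)))
    pen : next p q (suc k) ≈ next p′ q′ (suc k)
    pen rewrite next-penultimate p q | next-penultimate p′ q′ = pp (suc k) (ℕ.n≤1+n _)
    last : next p q (2 ℕ.+ k) ≈ next p′ q′ (2 ℕ.+ k)
    last rewrite next-last p q | next-last p′ q′ = ≈-refl

  prev-cong : ∀ {q q′ t t′} → q ~ q′ → t ~ t′ → prev q t ~ prev q′ t′
  prev-cong qq tt 0 _ = ≈-refl
  prev-cong qq tt 1 _ = tt 1 (s≤s z≤n)
  prev-cong qq tt (suc (suc i)) (s≤s (s≤s i≤k)) =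
    -‿cong (*-cong (*-cong (tt k (ℕ.m≤n+m k 2)) (tt (suc k) (ℕ.n≤1+n _))) (qq (suc i) (s≤s (ℕ.m≤n⇒m≤1+n i≤k))))
           (tt i (ℕ.m≤n⇒m≤o+n 2 i≤k))

  orbit : Row → Row → ℤ → Row × Row
  orbit p q (+ zero)     = p , q
  orbit p q (+ suc i)    = let (r , s) = orbit p q (+ i) in s , next r s
  orbit p q -[1+ zero ]  = prev p q , p
  orbit p q -[1+ suc i ] = let (r , s) = orbit p q -[1+ i ] in prev r s , r

  module Orbit {p q : Row} (a : Adjacent p q) where

    row row′ : ℤ → Row
    row  u = proj₁ (orbit p q u)
    row′ u = proj₂ (orbit p q u)

    adjacent : ∀ u → Adjacent (row u) (row′ u)
    adjacent (+ zero)     = a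
    adjacent (+ suc i)    = next-adjacent (adjacent (+ i))
    adjacent -[1+ zero ]  = prev-adjacent a
    adjacent -[1+ suc i ] = prev-adjacent (adjacent -[1+ i ])

    row-suc : ∀ u → row (ℤ.suc u) ~ row′ u
    row-suc (+ i)        _ _ = ≈-refl
    row-suc -[1+ zero ]  _ _ = ≈-refl
    row-suc -[1+ suc i ] _ _ = ≈-refl

    row′-suc : ∀ u → row′ (ℤ.suc u) ~ next (row u) (row′ u)
    row′-suc (+ i)        _ _ = ≈-refl
    row′-suc -[1+ zero ]  = ~-sym (next-prev a)
    row′-suc -[1+ suc i ] = ~-sym (next-prev (adjacent -[1+ i ]))

  -- A tame frieze seen as a sequence of rows, with the vanishing determinants replaced by the
  -- recurrence `evolves`. It links `TameFrieze` with the orbits of `next` and `prev`.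
  record FriezeRows (r : ℤ → Row) : Set where
    field
      adjacent : ∀ u → Adjacent (r u) (r (ℤ.suc u))
      evolves  : ∀ u → r (ℤ.suc (ℤ.suc u)) ~ next (r u) (r (ℤ.suc u))

  orbit-friezeRows : ∀ {p q} (a : Adjacent p q) → FriezeRows (Orbit.row a)
  orbit-friezeRows a = record
    { adjacent = λ u → Adjacent-resp (λ _ _ → ≈-refl) (~-sym (row-suc u)) (adjacent u)
    ; evolves  = λ u → ~-trans (row-suc (ℤ.suc u)) (~-trans (row′-suc u)
                   (next-cong (λ _ _ → ≈-refl) (~-sym (row-suc u))))
    }
    where open Orbit a

  -- The recurrence can be solved in both directions: `back` reverses `evolves` by means of
  -- `prev-next`, so agreement in rows 0 and 1 spreads to all integers.
  friezeRows-unique : ∀ {r p q} (a : Adjacent p q) → FriezeRows r → p ~ r (+ 0) → q ~ r (+ 1) →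
                      ∀ u → Orbit.row a u ~ r u
  friezeRows-unique {r} {p} {q} a fr pp qq u = proj₁ (both u)
    where
    open Orbit a using (row; row′)
    open FriezeRows fr
    back : ∀ u → prev (r (ℤ.suc u)) (r (ℤ.suc (ℤ.suc u))) ~ r u
    back u = ~-trans (prev-cong (λ _ _ → ≈-refl) (evolves u)) (prev-next (adjacent u))
    both : ∀ u → row u ~ r u × row′ u ~ r (ℤ.suc u)
    both (+ zero)     = pp , qq
    both (+ suc i)    = let (x , y) = both (+ i) in y , ~-trans (next-cong x y) (~-sym (evolves (+ i)))
    both -[1+ zero ]  = ~-trans (prev-cong pp qq) (back -[1+ 0 ]) , pp
    both -[1+ suc i ] = let (x , y) = both -[1+ i ] in ~-trans (prev-cong x y) (back -[1+ suc i ]) , x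

-- Tame friezes as bi-infinite sequences of rows

module Friezes (n k : ℕ) .{{_ : NonZero n}} where
  open Modular n
  open Residue
  open Rows n k

  private
    m : ℕ
    m = 2 ℕ.+ k

  rowOf : Entries n m → ℤ → Row
  rowOf F u i with i <? suc m
  ... | yes i< = ⟦ F u (fromℕ< i<) ⟧
  ... | no _   = + 0

  entry-rowOf : ∀ (F : Entries n m) u v {i} → v - u ≡ + i → entry F u v ≡ rowOf F u i
  entry-rowOf F u v {i} eq with v - u
  entry-rowOf F u v {i} refl | .(+ i) with i <? suc m
  ... | yes _ = refl
  ... | no _  = refl

  rowOf-toℕ : ∀ (F : Entries n m) u i → rowOf F u (toℕ i) ≡ ⟦ F u i ⟧
  rowOf-toℕ F u i with toℕ i <? suc m
  ... | yes i< = cong (⟦_⟧ ∘ F u) (Fin.fromℕ<-toℕ i i<)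
  ... | no i≮  = contradiction (Fin.toℕ<n i) i≮

  offset : ∀ u i → (u + + i) - u ≡ + i
  offset u i = cancel u (+ i)
    where
    cancel : ∀ u i → (u + i) - u ≡ i
    cancel = solve-∀

  shift : ∀ u v {i} a b c → v - u ≡ + i → i ℕ.+ a ≡ c ℕ.+ b → (v + + a) - (u + + b) ≡ + c
  shift u v a b c eq eq′ = trans (regroup v u (+ a) (+ b))
    (trans (cong (λ x → x + + a - + b) eq)
      (trans (cong (λ x → + x - + b) eq′) (cancel (+ c) (+ b))))
    where
    regroup : ∀ v u a b → (v + a) - (u + b) ≡ (v - u) + a - b
    regroup = solve-∀
    cancel : ∀ c b → c + b - b ≡ c
    cancel = solve-∀

  entry-both : ∀ (F : Entries n m) u v {i} a b c → v - u ≡ + i → i ℕ.+ a ≡ c ℕ.+ b →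
            entry F (u + + b) (v + + a) ≡ rowOf F (u + + b) c
  entry-both F u v a b c eq eq′ = entry-rowOf F (u + + b) (v + + a) (shift u v a b c eq eq′)

  entry-left : ∀ (F : Entries n m) u v {i} b c → v - u ≡ + i → i ≡ c ℕ.+ b →
             entry F (u + + b) v ≡ rowOf F (u + + b) c
  entry-left F u v {i} b c eq eq′ =
    entry-rowOf F (u + + b) v (trans (cong (_- (u + + b)) (sym (ℤ.+-identityʳ v)))
                         (shift u v 0 b c eq (trans (ℕ.+-identityʳ i) eq′)))

  entry-right : ∀ (F : Entries n m) u v {i} a c → v - u ≡ + i → i ℕ.+ a ≡ c →
             entry F u (v + + a) ≡ rowOf F u c
  entry-right F u v a c eq eq′ =
    entry-rowOf F u (v + + a) (trans (cong (λ x → v + + a - x) (sym (ℤ.+-identityʳ u)))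
                         (shift u v a 0 c eq (trans eq′ (sym (ℕ.+-identityʳ c)))))

  det3-cong : ∀ {a b c d e f g h i a′ b′ c′ d′ e′ f′ g′ h′ i′} →
    a ≡ a′ → b ≡ b′ → c ≡ c′ → d ≡ d′ → e ≡ e′ → f ≡ f′ → g ≡ g′ → h ≡ h′ → i ≡ i′ →
    det3 a b c d e f g h i ≡ det3 a′ b′ c′ d′ e′ f′ g′ h′ i′
  det3-cong refl refl refl refl refl refl refl refl refl = refl

  module _ (F : Entries n m) where

    private
      r : ℤ → Row
      r = rowOf F

    -- The indices are staggered because each row is read by distance from its own first zero:
    -- raising u by one lowers the index of the same v by one.
    Determinant : ℤ → ℕ → ℤ
    Determinant u j =
      det3 (r u (2 ℕ.+ j))         (r u (3 ℕ.+ j))         (r u (4 ℕ.+ j))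
           (r (u + + 1) (1 ℕ.+ j)) (r (u + + 1) (2 ℕ.+ j)) (r (u + + 1) (3 ℕ.+ j))
           (r (u + + 2) j)         (r (u + + 2) (1 ℕ.+ j)) (r (u + + 2) (2 ℕ.+ j))

    diamond-entries : ∀ u v j → v - u ≡ + (1 ℕ.+ j) →
      entry F u v * entry F (u + + 1) (v + + 1) - entry F (u + + 1) v * entry F u (v + + 1)
      ≡ r u (1 ℕ.+ j) * r (u + + 1) (1 ℕ.+ j) - r (u + + 1) j * r u (2 ℕ.+ j)
    diamond-entries u v j eq = cong₂ _-_
      (cong₂ _*_ (entry-rowOf F u v eq) (entry-both F u v 1 1 (1 ℕ.+ j) eq refl))
      (cong₂ _*_ (entry-left F u v 1 j eq (ℕ.+-comm 1 j))
                 (entry-right F u v 1 (2 ℕ.+ j) eq (cong suc (ℕ.+-comm j 1))))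

    determinant-entries : ∀ u v j → v - u ≡ + (2 ℕ.+ j) →
      det3 (entry F u v)         (entry F u (v + + 1))         (entry F u (v + + 2))
           (entry F (u + + 1) v) (entry F (u + + 1) (v + + 1)) (entry F (u + + 1) (v + + 2))
           (entry F (u + + 2) v) (entry F (u + + 2) (v + + 1)) (entry F (u + + 2) (v + + 2))
      ≡ Determinant u j
    determinant-entries u v j eq = det3-cong
      (entry-rowOf F u v eq)
      (entry-right F u v 1 (3 ℕ.+ j) eq (cong (2 ℕ.+_) (ℕ.+-comm j 1)))
      (entry-right F u v 2 (4 ℕ.+ j) eq (cong (2 ℕ.+_) (ℕ.+-comm j 2)))
      (entry-left F u v 1 (1 ℕ.+ j) eq (cong suc (ℕ.+-comm 1 j)))
      (entry-both F u v 1 1 (2 ℕ.+ j) eq refl)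
      (entry-both F u v 2 1 (3 ℕ.+ j) eq (cong (2 ℕ.+_) (trans (ℕ.+-comm j 2) (cong suc (ℕ.+-comm 1 j)))))
      (entry-left F u v 2 j eq (ℕ.+-comm 2 j))
      (entry-both F u v 1 2 (1 ℕ.+ j) eq (cong suc (trans (cong suc (ℕ.+-comm j 1)) (ℕ.+-comm 2 j))))
      (entry-both F u v 2 2 (2 ℕ.+ j) eq refl)

  suc-+1 : ∀ u → u + + 1 ≡ ℤ.suc u
  suc-+1 u = ℤ.+-comm u (+ 1)

  suc-+2 : ∀ u → u + + 2 ≡ ℤ.suc (ℤ.suc u)
  suc-+2 u = trans (ℤ.+-comm u (+ 2)) (ℤ.+-assoc (+ 1) (+ 1) u)

  module Evaluate (F : TameFrieze n m) where
    open TameFrieze F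

    private
      r : ℤ → Row
      r = rowOf E

    r-first : ∀ u → r u 0 ≈ + 0
    r-first u = ≈-reflexive (trans (sym (entry-rowOf E u u (ℤ.+-inverseʳ u))) (firstRow u))

    r-last : ∀ u → r u m ≈ + 0
    r-last u = ≈-reflexive (trans (sym (entry-rowOf E u (u + + m) (offset u m))) (lastRow u))

    r-diamond : ∀ u j → j ℕ.≤ k → r u (1 ℕ.+ j) * r (ℤ.suc u) (1 ℕ.+ j) - r (ℤ.suc u) j * r u (2 ℕ.+ j) ≈ + 1
    r-diamond u j j≤k = subst (λ w → r u (1 ℕ.+ j) * r w (1 ℕ.+ j) - r w j * r u (2 ℕ.+ j) ≈ + 1) (suc-+1 u)
      (≈-trans (≈-sym (≈-reflexive (diamond-entries E u (u + + (1 ℕ.+ j)) j eq)))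
        (≅⇒≈ (unimodular u (u + + (1 ℕ.+ j)) (subst (+ 1 ℤ.≤_) (sym eq) (+≤+ (s≤s z≤n)))
                                            (subst (ℤ._≤ + (1 ℕ.+ k)) (sym eq) (+≤+ (s≤s j≤k))))))
      where
      eq : (u + + (1 ℕ.+ j)) - u ≡ + (1 ℕ.+ j)
      eq = offset u (1 ℕ.+ j)

    r-adjacent : ∀ u → Adjacent (r u) (r (ℤ.suc u))
    r-adjacent u = record
      { p-first = r-first u
      ; p-last  = r-last u
      ; q-first = r-first (ℤ.suc u)
      ; q-last  = r-last (ℤ.suc u)
      ; diamond = r-diamond u
      }

    r-determinant : ∀ u j → 2 ℕ.+ j ℕ.≤ k →
      det3 (r u (2 ℕ.+ j)) (r u (3 ℕ.+ j)) (r u (4 ℕ.+ j))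
           (r (ℤ.suc u) (1 ℕ.+ j)) (r (ℤ.suc u) (2 ℕ.+ j)) (r (ℤ.suc u) (3 ℕ.+ j))
           (r (ℤ.suc (ℤ.suc u)) j) (r (ℤ.suc (ℤ.suc u)) (1 ℕ.+ j)) (r (ℤ.suc (ℤ.suc u)) (2 ℕ.+ j)) ≈ + 0
    r-determinant u j 2+j≤k = subst₂ (λ w x →
      det3 (r u (2 ℕ.+ j)) (r u (3 ℕ.+ j)) (r u (4 ℕ.+ j))
           (r w (1 ℕ.+ j)) (r w (2 ℕ.+ j)) (r w (3 ℕ.+ j))
           (r x j) (r x (1 ℕ.+ j)) (r x (2 ℕ.+ j)) ≈ + 0) (suc-+1 u) (suc-+2 u)
      (≈-trans (≈-sym (≈-reflexive (determinant-entries E u (u + + (2 ℕ.+ j)) j eq)))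
        (≅⇒≈ (tame u (u + + (2 ℕ.+ j)) (subst (+ 2 ℤ.≤_) (sym eq) (+≤+ (s≤s (s≤s z≤n))))
                                      (subst (ℤ._≤ + k) (sym eq) (+≤+ 2+j≤k)))))
      where
      eq : (u + + (2 ℕ.+ j)) - u ≡ + (2 ℕ.+ j)
      eq = offset u (2 ℕ.+ j)

    -- The first two columns satisfy t = d q - p by the border and the diamonds alone; each further
    -- inner column follows from the two before it through a vanishing determinant. In the
    -- penultimate column t and p both invert the same entry of q, and the last column is zero.
    r-evolves : ∀ u → r (ℤ.suc (ℤ.suc u)) ~ next (r u) (r (ℤ.suc u))
    r-evolves u = by-position _
      (λ i i≤k → ≈-trans (inner i i≤k) (≈-sym (≈-reflexive (next-inner p q i i≤k))))
      (≈-trans pen (≈-sym (≈-reflexive (next-penultimate p q))))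
      (≈-trans (q-last a′) (≈-sym (≈-reflexive (next-last p q))))
      where
      open Adjacent
      p q t : Row
      p = r u
      q = r (ℤ.suc u)
      t = r (ℤ.suc (ℤ.suc u))
      a : Adjacent p q
      a = r-adjacent u
      a′ : Adjacent q t
      a′ = r-adjacent (ℤ.suc u)
      d : ℤ
      d = p 2 * p 1
      id₀ : ∀ p₁ p₂ q₁ t₀ → t₀ - (p₂ * p₁ * q₁ - p₂) ≡ + 1 * (t₀ - + 0) + (- p₂) * (p₁ * q₁ - + 1)
      id₀ = solve-∀
      id₁ : ∀ p₁ p₂ p₃ q₁ q₂ t₁ → t₁ - (p₂ * p₁ * q₂ - p₃) ≡
            p₁ * (q₁ * t₁ - + 1) + (- p₁) * (p₂ * q₂ - q₁ * p₃ - + 1) + (- (t₁ + p₃)) * (p₁ * q₁ - + 1)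
      id₁ = solve-∀
      -- Once two columns satisfy t = d q − p, the determinant is the defect of the third column
      -- times a diamond, that is, times 1.
      expand : ∀ d p₂ p₃ p₄ q₁ q₂ q₃ t₀ t₁ t₂ →
        (p₂ * (q₂ * t₂ - q₃ * t₁) - p₃ * (q₁ * t₂ - q₃ * t₀) + p₄ * (q₁ * t₁ - q₂ * t₀))
          - (t₂ - (d * q₃ - p₄)) * (p₂ * q₂ - q₁ * p₃)
        ≡ (p₃ * q₃ - p₄ * q₂) * (t₀ - (d * q₁ - p₂)) + (p₄ * q₁ - p₂ * q₃) * (t₁ - (d * q₂ - p₃))
      expand = solve-∀
      id₂ : ∀ z y D M → z - y ≡ + 1 * (D - + 0) + (- + 1) * (D - (z - y) * M) + (- (z - y)) * (M - + 1)
      id₂ = solve-∀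
      Inner : ℕ → Set
      Inner i = t i ≈ d * q (suc i) - p (2 ℕ.+ i)
      step : ∀ j → 2 ℕ.+ j ℕ.≤ k → Inner j → Inner (suc j) → Inner (2 ℕ.+ j)
      step j 2+j≤k ih₀ ih₁ =
        lincomb₃ (+ 1) (- + 1) (- (t (2 ℕ.+ j) - (d * q (3 ℕ.+ j) - p (4 ℕ.+ j))))
          (r-determinant u j 2+j≤k) det≈ (diamond a (suc j) (ℕ.<⇒≤ 2+j≤k))
          (id₂ (t (2 ℕ.+ j)) (d * q (3 ℕ.+ j) - p (4 ℕ.+ j))
            (det3 (p (2 ℕ.+ j)) (p (3 ℕ.+ j)) (p (4 ℕ.+ j))
                  (q (1 ℕ.+ j)) (q (2 ℕ.+ j)) (q (3 ℕ.+ j)) (t j) (t (1 ℕ.+ j)) (t (2 ℕ.+ j)))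
            (p (2 ℕ.+ j) * q (2 ℕ.+ j) - q (1 ℕ.+ j) * p (3 ℕ.+ j)))
        where
        det≈ : det3 (p (2 ℕ.+ j)) (p (3 ℕ.+ j)) (p (4 ℕ.+ j))
                    (q (1 ℕ.+ j)) (q (2 ℕ.+ j)) (q (3 ℕ.+ j)) (t j) (t (1 ℕ.+ j)) (t (2 ℕ.+ j))
             ≈ (t (2 ℕ.+ j) - (d * q (3 ℕ.+ j) - p (4 ℕ.+ j))) * (p (2 ℕ.+ j) * q (2 ℕ.+ j) - q (1 ℕ.+ j) * p (3 ℕ.+ j))
        det≈ = lincomb₂ (p (3 ℕ.+ j) * q (3 ℕ.+ j) - p (4 ℕ.+ j) * q (2 ℕ.+ j))
                        (p (4 ℕ.+ j) * q (1 ℕ.+ j) - p (2 ℕ.+ j) * q (3 ℕ.+ j))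
          ih₀ ih₁
          (expand d (p (2 ℕ.+ j)) (p (3 ℕ.+ j)) (p (4 ℕ.+ j))
                  (q (1 ℕ.+ j)) (q (2 ℕ.+ j)) (q (3 ℕ.+ j)) (t j) (t (1 ℕ.+ j)) (t (2 ℕ.+ j)))
      inner : ∀ i → i ℕ.≤ k → Inner i
      inner 0 _ = lincomb₂ (+ 1) (- p 2) (q-first a′) (first-inverse a) (id₀ (p 1) (p 2) (q 1) (t 0))
      -- The diamond p 2 q 2 - q 1 p 3 = 1 multiplied by p 1 gives d q 2 - p 3 = p 1, and p 1 and t
      -- 1 both invert q 1.
      inner 1 1≤k = lincomb₃ (p 1) (- p 1) (- (t 1 + p 3)) (first-inverse a′) (diamond a 1 1≤k) (first-inverse a)
        (id₁ (p 1) (p 2) (p 3) (q 1) (q 2) (t 1))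
      inner (suc (suc j)) 2+j≤k =
        step j 2+j≤k (inner j (ℕ.≤-trans (ℕ.m≤n+m j 2) 2+j≤k)) (inner (suc j) (ℕ.<⇒≤ 2+j≤k))
      pen : t (suc k) ≈ p (suc k)
      pen = inverse-unique (inverse-sym (q (suc k)) (t (suc k)) (last-inverse a′)) (last-inverse a)

    friezeRows : FriezeRows r
    friezeRows = record { adjacent = r-adjacent ; evolves = r-evolves }

  -- The border conditions of `TameFrieze` are equalities in ℤ, so a congruence to 0 has to be
  -- upgraded: the canonical residue of 0 is 0 itself.
  ⟦residue⟧≡0 : ∀ {a} → a ≈ + 0 → ⟦ residue a ⟧ ≡ + 0
  ⟦residue⟧≡0 p = trans (cong ⟦_⟧ (residue-cong p))
    (cong +_ (trans (Fin.toℕ-fromℕ< _) (ℕ.m<n⇒m%n≡m (ℕ.>-nonZero⁻¹ n))))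

  module Realise {r : ℤ → Row} (fr : FriezeRows r) where
    open FriezeRows fr
    open Adjacent

    E : Entries n m
    E u i = residue (r u (toℕ i))

    rowOf-E : ∀ u i → i ℕ.≤ m → rowOf E u i ≡ ⟦ residue (r u i) ⟧
    rowOf-E u i i≤m with i <? suc m
    ... | yes i< = cong (λ j → ⟦ residue (r u j) ⟧) (Fin.toℕ-fromℕ< i<)
    ... | no i≮  = contradiction (s≤s i≤m) i≮

    rowOf-E≈ : ∀ u → rowOf E u ~ r u
    rowOf-E≈ u i i≤m = ≈-trans (≈-reflexive (rowOf-E u i i≤m)) (⟦residue⟧ _)

    frieze : TameFrieze n m
    frieze = record
      { E = E
      ; firstRow = λ u → trans (entry-rowOf E u u (ℤ.+-inverseʳ u))
                     (trans (rowOf-E u 0 z≤n) (⟦residue⟧≡0 (p-first (adjacent u))))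
      ; lastRow  = λ u → trans (entry-rowOf E u (u + + m) (offset u m))
                     (trans (rowOf-E u m ℕ.≤-refl) (⟦residue⟧≡0 (p-last (adjacent u))))
      ; unimodular = uni
      ; tame = tam
      }
      where
      adj : ∀ u → Adjacent (rowOf E u) (rowOf E (u + + 1))
      adj u = Adjacent-resp (~-sym (rowOf-E≈ u)) (~-sym (rowOf-E≈ (u + + 1)))
                (subst (λ w → Adjacent (r u) (r w)) (sym (suc-+1 u)) (adjacent u))
      evo : ∀ u → rowOf E (u + + 2) ~ next (rowOf E u) (rowOf E (u + + 1))
      evo u = ~-trans (rowOf-E≈ (u + + 2)) (~-trans
        (subst₂ (λ x w → r x ~ next (r u) (r w)) (sym (suc-+2 u)) (sym (suc-+1 u)) (evolves u))
        (~-sym (next-cong (rowOf-E≈ u) (rowOf-E≈ (u + + 1)))))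
      uni : ∀ u v → + 1 ℤ.≤ v - u → v - u ℤ.≤ + (1 ℕ.+ k) →
        entry E u v * entry E (u + + 1) (v + + 1) - entry E (u + + 1) v * entry E u (v + + 1) ≅ + 1 [mod n ]
      uni u v lo hi = ≈⇒≅ (go (v - u) refl lo hi)
        where
        go : ∀ i → v - u ≡ i → + 1 ℤ.≤ i → i ℤ.≤ + (1 ℕ.+ k) →
          entry E u v * entry E (u + + 1) (v + + 1) - entry E (u + + 1) v * entry E u (v + + 1) ≈ + 1
        go (+ suc j) eq _ (+≤+ (s≤s j≤k)) =
          ≈-trans (≈-reflexive (diamond-entries E u v j eq)) (diamond (adj u) j j≤k)
        go (+ zero) eq (+≤+ ()) _
      -- Replacing the third row t by the defects t - (d q - p) leaves the determinant unchanged;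
      -- their coefficients are the signed 2×2 minors of the first two rows.
      expand : ∀ d p₂ p₃ p₄ q₁ q₂ q₃ t₀ t₁ t₂ →
        (p₂ * (q₂ * t₂ - q₃ * t₁) - p₃ * (q₁ * t₂ - q₃ * t₀) + p₄ * (q₁ * t₁ - q₂ * t₀)) - + 0
        ≡ (p₃ * q₃ - p₄ * q₂) * (t₀ - (d * q₁ - p₂)) + (p₄ * q₁ - p₂ * q₃) * (t₁ - (d * q₂ - p₃))
          + (p₂ * q₂ - p₃ * q₁) * (t₂ - (d * q₃ - p₄))
      expand = solve-∀
      tam : ∀ u v → + 2 ℤ.≤ v - u → v - u ℤ.≤ + k →
        det3 (entry E u v)       (entry E u (v + + 1))       (entry E u (v + + 2))
             (entry E (u + + 1) v) (entry E (u + + 1) (v + + 1)) (entry E (u + + 1) (v + + 2))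
             (entry E (u + + 2) v) (entry E (u + + 2) (v + + 1)) (entry E (u + + 2) (v + + 2))
        ≅ + 0 [mod n ]
      tam u v lo hi = ≈⇒≅ (go (v - u) refl lo hi)
        where
        p q t : Row
        p = rowOf E u
        q = rowOf E (u + + 1)
        t = rowOf E (u + + 2)
        inner : ∀ i → i ℕ.≤ k → t i ≈ p 2 * p 1 * q (suc i) - p (2 ℕ.+ i)
        inner i i≤k = ≈-trans (evo u i (ℕ.m≤n⇒m≤o+n 2 i≤k)) (≈-reflexive (next-inner p q i i≤k))
        go : ∀ i → v - u ≡ i → + 2 ℤ.≤ i → i ℤ.≤ + k →
          det3 (entry E u v)       (entry E u (v + + 1))       (entry E u (v + + 2))
               (entry E (u + + 1) v) (entry E (u + + 1) (v + + 1)) (entry E (u + + 1) (v + + 2))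
               (entry E (u + + 2) v) (entry E (u + + 2) (v + + 1)) (entry E (u + + 2) (v + + 2)) ≈ + 0
        go (+ suc (suc j)) eq _ (+≤+ 2+j≤k) =
          ≈-trans (≈-reflexive (determinant-entries E u v j eq))
            (lincomb₃ (p (3 ℕ.+ j) * q (3 ℕ.+ j) - p (4 ℕ.+ j) * q (2 ℕ.+ j))
                      (p (4 ℕ.+ j) * q (1 ℕ.+ j) - p (2 ℕ.+ j) * q (3 ℕ.+ j))
                      (p (2 ℕ.+ j) * q (2 ℕ.+ j) - p (3 ℕ.+ j) * q (1 ℕ.+ j))
              (inner j (ℕ.≤-trans (ℕ.m≤n+m j 2) 2+j≤k)) (inner (suc j) (ℕ.<⇒≤ 2+j≤k)) (inner (2 ℕ.+ j) 2+j≤k)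
              (expand (p 2 * p 1) (p (2 ℕ.+ j)) (p (3 ℕ.+ j)) (p (4 ℕ.+ j))
                (q (1 ℕ.+ j)) (q (2 ℕ.+ j)) (q (3 ℕ.+ j)) (t j) (t (1 ℕ.+ j)) (t (2 ℕ.+ j))))
        go (+ suc zero) eq (+≤+ (s≤s ())) _
        go (+ zero) eq (+≤+ ()) _

-- Friezes from quiddity data

module Quiddity (n : ℕ) .{{_ : NonZero n}} where
  open Modular n
  open Residue

  advance : ℤ → ℤ → Fin n → ℤ
  advance x₀ x₁ c = ⟦ c ⟧ * x₁ - x₀

  endpoint : ℤ → ℤ → ∀ {j} → Vec (Fin n) j → ℤ
  endpoint x₀ x₁ []       = x₁
  endpoint x₀ x₁ (c ∷ cs) = endpoint x₁ (advance x₀ x₁ c) cs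

  -- The closing value z stands at index j + 2; the zeros beyond it are junk.
  path : ℤ → ℤ → ℤ → ∀ {j} → Vec (Fin n) j → Row
  path z x₀ x₁ []       0       = x₀
  path z x₀ x₁ []       1       = x₁
  path z x₀ x₁ []       2       = z
  path z x₀ x₁ []       (suc (suc (suc _))) = + 0
  path z x₀ x₁ (c ∷ cs) 0       = x₀
  path z x₀ x₁ (c ∷ cs) (suc i) = path z x₁ (advance x₀ x₁ c) cs i

  module _ (z : ℤ) where

    path-0 : ∀ x₀ x₁ {j} (cs : Vec (Fin n) j) → path z x₀ x₁ cs 0 ≡ x₀
    path-0 x₀ x₁ []      = refl
    path-0 x₀ x₁ (_ ∷ _) = refl

    path-1 : ∀ x₀ x₁ {j} (cs : Vec (Fin n) j) → path z x₀ x₁ cs 1 ≡ x₁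
    path-1 x₀ x₁ []       = refl
    path-1 x₀ x₁ (c ∷ cs) = path-0 x₁ (advance x₀ x₁ c) cs

    path-endpoint : ∀ x₀ x₁ {j} (cs : Vec (Fin n) j) → path z x₀ x₁ cs (suc j) ≡ endpoint x₀ x₁ cs
    path-endpoint x₀ x₁ []       = refl
    path-endpoint x₀ x₁ (c ∷ cs) = path-endpoint x₁ (advance x₀ x₁ c) cs

    path-closing : ∀ x₀ x₁ {j} (cs : Vec (Fin n) j) → path z x₀ x₁ cs (2 ℕ.+ j) ≡ z
    path-closing x₀ x₁ []       = refl
    path-closing x₀ x₁ (c ∷ cs) = path-closing x₁ (advance x₀ x₁ c) cs

    path-beyond : ∀ x₀ x₁ {j} (cs : Vec (Fin n) j) → path z x₀ x₁ cs (3 ℕ.+ j) ≡ + 0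
    path-beyond x₀ x₁ []       = refl
    path-beyond x₀ x₁ (c ∷ cs) = path-beyond x₁ (advance x₀ x₁ c) cs

  det-advance : ∀ x₀ x₁ y₀ y₁ c → x₀ * y₁ - y₀ * x₁ ≈ + 1 →
                x₁ * advance y₀ y₁ c - y₁ * advance x₀ x₁ c ≈ + 1
  det-advance x₀ x₁ y₀ y₁ c d = lincomb₁ (+ 1) d (id x₀ x₁ y₀ y₁ ⟦ c ⟧)
    where
    id : ∀ x₀ x₁ y₀ y₁ c → x₁ * (c * y₁ - y₀) - y₁ * (c * x₁ - x₀) - + 1 ≡ + 1 * (x₀ * y₁ - y₀ * x₁ - + 1)
    id = solve-∀

  -- Both paths share their coefficients, so every step acts on the pair of columns by a matrix of
  -- determinant 1. Only the last determinant involves the closing values 0 and f, and it is the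
  -- endpoint times f.
  path-det : ∀ x₀ x₁ y₀ y₁ f {j} (cs : Vec (Fin n) j) →
             x₀ * y₁ - y₀ * x₁ ≈ + 1 → endpoint x₀ x₁ cs * f ≈ + 1 →
             let x = path (+ 0) x₀ x₁ cs ; y = path f y₀ y₁ cs in
             ∀ i → i ℕ.≤ suc j → x i * y (suc i) - y i * x (suc i) ≈ + 1
  path-det x₀ x₁ y₀ y₁ f [] d e 0 _ = d
  path-det x₀ x₁ y₀ y₁ f [] d e 1 _ = lincomb₁ (+ 1) e (id x₁ f y₁)
    where
    id : ∀ x f y → x * f - y * + 0 - + 1 ≡ + 1 * (x * f - + 1)
    id = solve-∀
  path-det x₀ x₁ y₀ y₁ f [] d e (suc (suc i)) (s≤s ())
  path-det x₀ x₁ y₀ y₁ f (c ∷ cs) d e zero _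
    rewrite path-0 (+ 0) x₁ (advance x₀ x₁ c) cs | path-0 f y₁ (advance y₀ y₁ c) cs = d
  path-det x₀ x₁ y₀ y₁ f (c ∷ cs) d e (suc i) (s≤s i≤) =
    path-det x₁ (advance x₀ x₁ c) y₁ (advance y₀ y₁ c) f cs (det-advance x₀ x₁ y₀ y₁ c d) e i i≤

  -- If w₂ = c w₁ - w₀ and det(w₀, w₁) = 1, then det(w₀, w₂) = c, which recovers c without a
  -- division.
  coefficients : Row → Row → ∀ j → Vec (Fin n) j
  coefficients x y zero    = []
  coefficients x y (suc j) = residue (x 0 * y 2 - y 0 * x 2) ∷ coefficients (x ∘ suc) (y ∘ suc) j

  coefficients-cong : ∀ j {x x′ y y′} → (∀ i → i ℕ.≤ suc j → x i ≈ x′ i) →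
                      (∀ i → i ℕ.≤ suc j → y i ≈ y′ i) → coefficients x y j ≡ coefficients x′ y′ j
  coefficients-cong zero    xx yy = refl
  coefficients-cong (suc j) xx yy = cong₂ _∷_
    (residue-cong (-‿cong (*-cong (xx 0 z≤n) (yy 2 (s≤s (s≤s z≤n)))) (*-cong (yy 0 z≤n) (xx 2 (s≤s (s≤s z≤n))))))
    (coefficients-cong j (λ i i≤ → xx (suc i) (s≤s i≤)) (λ i i≤ → yy (suc i) (s≤s i≤)))

  coefficients-path : ∀ z z′ x₀ x₁ y₀ y₁ {j} (cs : Vec (Fin n) j) → x₀ * y₁ - y₀ * x₁ ≈ + 1 →
                      coefficients (path z x₀ x₁ cs) (path z′ y₀ y₁ cs) j ≡ cs
  coefficients-path z z′ x₀ x₁ y₀ y₁ []       d = refl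
  coefficients-path z z′ x₀ x₁ y₀ y₁ (c ∷ cs) d = cong₂ _∷_ head
    (coefficients-path z z′ x₁ (advance x₀ x₁ c) y₁ (advance y₀ y₁ c) cs (det-advance x₀ x₁ y₀ y₁ c d))
    where
    id : ∀ x₀ x₁ y₀ y₁ c → x₀ * (c * y₁ - y₀) - y₀ * (c * x₁ - x₀) - c ≡ c * (x₀ * y₁ - y₀ * x₁ - + 1)
    id = solve-∀
    head : residue (x₀ * path z′ y₁ (advance y₀ y₁ c) cs 1 - y₀ * path z x₁ (advance x₀ x₁ c) cs 1) ≡ c
    head rewrite path-1 z x₁ (advance x₀ x₁ c) cs | path-1 z′ y₁ (advance y₀ y₁ c) cs =
      trans (residue-cong {x₀ * advance y₀ y₁ c - y₀ * advance x₀ x₁ c} {⟦ c ⟧}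
              (lincomb₁ ⟦ c ⟧ d (id x₀ x₁ y₀ y₁ ⟦ c ⟧))) (residue-⟦⟧ c)

  -- The row `s` is kept apart from the pair (x, y) that defines the coefficients, so that one
  -- induction rebuilds both coordinates, with s = x and with s = y.
  path-coefficients : ∀ j (x y s : Row) {z s₀ s₁} → s₀ ≈ s 0 → s₁ ≈ s 1 → z ≈ s (2 ℕ.+ j) →
    (∀ i → i ℕ.< j → s (2 ℕ.+ i) ≈ (x i * y (2 ℕ.+ i) - y i * x (2 ℕ.+ i)) * s (suc i) - s i) →
    ∀ i → i ℕ.≤ 2 ℕ.+ j → path z s₀ s₁ (coefficients x y j) i ≈ s i
  path-coefficients zero x y s e₀ e₁ ez rec 0 _ = e₀
  path-coefficients zero x y s e₀ e₁ ez rec 1 _ = e₁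
  path-coefficients zero x y s e₀ e₁ ez rec 2 _ = ez
  path-coefficients zero x y s e₀ e₁ ez rec (suc (suc (suc i))) (s≤s (s≤s ()))
  path-coefficients (suc j) x y s e₀ e₁ ez rec zero    _        = e₀
  path-coefficients (suc j) x y s e₀ e₁ ez rec (suc i) (s≤s i≤) =
    path-coefficients j (x ∘ suc) (y ∘ suc) (s ∘ suc) e₁
      (≈-trans (-‿cong (*-cong (⟦residue⟧ (x 0 * y 2 - y 0 * x 2)) e₁) e₀) (≈-sym (rec 0 (s≤s z≤n))))
      ez (λ i i<j → rec (suc i) (s≤s i<j)) i i≤

  -- The inverse is taken among the n residues, so that an exhaustive search decides the property.
  Unit : ℤ → Set
  Unit a = ∃ λ (b : Fin n) → a * ⟦ b ⟧ ≈ + 1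

  inverse⇒unit : ∀ {a b} → a * b ≈ + 1 → Unit a
  inverse⇒unit {a} {b} p = residue b , ≈-trans (*-cong (≈-refl {a}) (⟦residue⟧ b)) p

  Unit-resp : ∀ {a b} → a ≈ b → Unit a → Unit b
  Unit-resp p (c , q) = c , ≈-trans (*-cong (≈-sym p) (≈-refl {⟦ c ⟧})) q

  -- A datum lists the starting value e, which follows the border value 0, and then the
  -- coefficients. The endpoint must be a unit because the closing column has first coordinate 0 and
  -- yet the last determinant is to be 1.
  Valid : ∀ {k} → Vec (Fin n) (suc k) → Set
  Valid (e ∷ cs) = Unit ⟦ e ⟧ × Unit (endpoint (+ 0) ⟦ e ⟧ cs)

  unit? : Decidable Unit
  unit? a = Fin.any? (λ b → a * ⟦ b ⟧ ≈? + 1)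

  valid? : ∀ {k} → Decidable (Valid {k})
  valid? (e ∷ cs) = unit? ⟦ e ⟧ ×-dec unit? (endpoint (+ 0) ⟦ e ⟧ cs)

  -- The column preceding those shared by two consecutive rows, so that every column of the
  -- pair (p , q) but the last two is governed by the same recurrence.
  prepend : Row → Row
  prepend q 0       = - q 1
  prepend q (suc i) = q i

  datumOf : ∀ k → Row → Row → Vec (Fin n) (suc k)
  datumOf k p q = residue (p 1) ∷ coefficients p (prepend q) k

  module _ (k : ℕ) where
    open Rows n k
    open Friezes n k

    datumOf-cong : ∀ {p p′ q q′} → p ~ p′ → q ~ q′ → datumOf k p q ≡ datumOf k p′ q′
    datumOf-cong {p} {p′} {q} {q′} pp qq = cong₂ _∷_ (residue-cong (pp 1 (s≤s z≤n)))
      (coefficients-cong k (λ i i≤ → pp i (ℕ.m≤n⇒m≤1+n i≤)) pre)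
      where
      pre : ∀ i → i ℕ.≤ suc k → prepend q i ≈ prepend q′ i
      pre zero    _  = lincomb₁ (- + 1) (qq 1 (s≤s z≤n)) (id (q 1) (q′ 1))
        where
        id : ∀ a b → (- a) - (- b) ≡ (- + 1) * (a - b)
        id = solve-∀
      pre (suc i) i≤ = qq i (ℕ.≤-trans (ℕ.n≤1+n i) (ℕ.m≤n⇒m≤1+n i≤))

    module FromData (e : Fin n) (cs : Vec (Fin n) k) (valid : Valid (e ∷ cs)) where

      ē f : Fin n
      ē = proj₁ (proj₁ valid)
      f = proj₁ (proj₂ valid)

      p y q : Row
      p = path (+ 0) (+ 0) ⟦ e ⟧ cs
      y = path ⟦ f ⟧ (- ⟦ ē ⟧) (+ 0) cs
      q = y ∘ suc

      det₀ : + 0 * + 0 - (- ⟦ ē ⟧) * ⟦ e ⟧ ≈ + 1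
      det₀ = lincomb₁ (+ 1) (proj₂ (proj₁ valid)) (id ⟦ e ⟧ ⟦ ē ⟧)
        where
        id : ∀ e e′ → + 0 * + 0 - (- e′) * e - + 1 ≡ + 1 * (e * e′ - + 1)
        id = solve-∀

      adjacent : Adjacent p q
      adjacent = record
        { p-first = ≈-reflexive (path-0 _ _ _ cs)
        ; p-last  = ≈-reflexive (path-closing _ _ _ cs)
        ; q-first = ≈-reflexive (path-1 _ _ _ cs)
        -- As q is y shifted by one, its last border entry is the default 0 just past the closing
        -- value of the path.
        ; q-last  = ≈-reflexive (path-beyond _ (- ⟦ ē ⟧) (+ 0) cs)
        ; diamond = λ j j≤k → path-det _ _ _ _ _ cs det₀ (proj₂ (proj₂ valid)) (suc j) (s≤s j≤k)
        }

      datumOf-adjacent : datumOf k p q ≡ e ∷ cs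
      datumOf-adjacent = cong₂ _∷_
        (trans (cong residue (path-1 _ _ _ cs)) (residue-⟦⟧ e))
        (trans (coefficients-cong k (λ _ _ → ≈-refl) pre)
               (coefficients-path _ _ _ _ _ _ cs det₀))
        where
        e*q₁ : ⟦ e ⟧ * q 1 ≈ + 1
        e*q₁ = subst (λ a → a * q 1 ≈ + 1) (path-1 _ _ _ cs) (Adjacent.first-inverse adjacent)
        pre : ∀ i → i ℕ.≤ suc k → prepend q i ≈ y i
        -- For k = 0 the entry q 1 is the closing value f, and for k > 0 it comes from the
        -- recurrence; uniqueness of the inverse of e identifies it with ē in both cases.
        pre zero _ = lincomb₃ (- ⟦ ē ⟧) (q 1) (- + 1) e*q₁ (proj₂ (proj₁ valid))
                       (≈-reflexive (path-0 ⟦ f ⟧ (- ⟦ ē ⟧) (+ 0) cs))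
                       (id (q 1) (y 0) ⟦ ē ⟧ ⟦ e ⟧)
          where
          id : ∀ a b c e → (- a) - b ≡ (- c) * (e * a - + 1) + a * (e * c - + 1) + (- + 1) * (b - (- c))
          id = solve-∀
        pre (suc i) _ = ≈-refl

      frieze : TameFrieze n (2 ℕ.+ k)
      frieze = Realise.frieze (orbit-friezeRows adjacent)

    frieze : ∀ (v : Vec (Fin n) (suc k)) → Valid v → TameFrieze n (2 ℕ.+ k)
    frieze (e ∷ cs) = FromData.frieze e cs

    datum : TameFrieze n (2 ℕ.+ k) → Vec (Fin n) (suc k)
    datum F = datumOf k (rowOf (TameFrieze.E F) (+ 0)) (rowOf (TameFrieze.E F) (+ 1))

    datum-frieze : ∀ (v : Vec (Fin n) (suc k)) (valid : Valid v) → datum (frieze v valid) ≡ v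
    datum-frieze (e ∷ cs) valid = trans
      (datumOf-cong (Realise.rowOf-E≈ fr (+ 0)) (Realise.rowOf-E≈ fr (+ 1)))
      datumOf-adjacent
      where
      open FromData e cs valid
      fr = orbit-friezeRows adjacent

    rowOf-cong : ∀ (E E′ : Entries n (2 ℕ.+ k)) → (∀ u i → E u i ≡ E′ u i) → ∀ u i → rowOf E u i ≡ rowOf E′ u i
    rowOf-cong E E′ eq u i with i <? suc (2 ℕ.+ k)
    ... | yes i< = cong ⟦_⟧ (eq u (fromℕ< i<))
    ... | no _   = refl

    datum-cong : ∀ {F G : TameFrieze n (2 ℕ.+ k)} → F ≈F G → datum F ≡ datum G
    datum-cong {F} {G} eq = datumOf-cong (rows (+ 0)) (rows (+ 1))
      where
      rows : ∀ u → rowOf (TameFrieze.E F) u ~ rowOf (TameFrieze.E G) u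
      rows u i _ = ≈-reflexive (rowOf-cong (TameFrieze.E F) (TameFrieze.E G) eq u i)

    module ToData {p q : Row} (a : Adjacent p q) where
      open Adjacent a

      private
        y : Row
        y = prepend q
        cs : Vec (Fin n) k
        cs = coefficients p y k

      det : ∀ i → i ℕ.≤ suc k → p i * y (suc i) - y i * p (suc i) ≈ + 1
      det zero    _         = lincomb₂ (+ 1) (q 0) first-inverse p-first (id (p 0) (p 1) (q 0) (q 1))
        where
        id : ∀ p₀ p₁ q₀ q₁ → p₀ * q₀ - (- q₁) * p₁ - + 1 ≡ + 1 * (p₁ * q₁ - + 1) + q₀ * (p₀ - + 0)
        id = solve-∀
      det (suc i) (s≤s i≤k) = diamond i i≤k

      -- Cramer's rule: w₂ = det(w₀, w₂) w₁ - det(w₁, w₂) w₀ when det(w₀, w₁) = 1, and here det(w₁,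
      -- w₂) = 1 as well. `y-rec` is the second coordinate of the same identity.
      p-rec : ∀ i → i ℕ.< k → p (2 ℕ.+ i) ≈ (p i * y (2 ℕ.+ i) - y i * p (2 ℕ.+ i)) * p (suc i) - p i
      p-rec i i<k = lincomb₂ (- p (2 ℕ.+ i)) (- p i) (det i (ℕ.m≤n⇒m≤1+n (ℕ.<⇒≤ i<k))) (det (suc i) (s≤s (ℕ.<⇒≤ i<k)))
        (id (p i) (p (suc i)) (p (2 ℕ.+ i)) (y i) (y (suc i)) (y (2 ℕ.+ i)))
        where
        id : ∀ x₀ x₁ x₂ y₀ y₁ y₂ → x₂ - ((x₀ * y₂ - y₀ * x₂) * x₁ - x₀)
             ≡ (- x₂) * (x₀ * y₁ - y₀ * x₁ - + 1) + (- x₀) * (x₁ * y₂ - y₁ * x₂ - + 1)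
        id = solve-∀

      y-rec : ∀ i → i ℕ.< k → y (2 ℕ.+ i) ≈ (p i * y (2 ℕ.+ i) - y i * p (2 ℕ.+ i)) * y (suc i) - y i
      y-rec i i<k = lincomb₂ (- y (2 ℕ.+ i)) (- y i) (det i (ℕ.m≤n⇒m≤1+n (ℕ.<⇒≤ i<k))) (det (suc i) (s≤s (ℕ.<⇒≤ i<k)))
        (id (p i) (p (suc i)) (p (2 ℕ.+ i)) (y i) (y (suc i)) (y (2 ℕ.+ i)))
        where
        id : ∀ x₀ x₁ x₂ y₀ y₁ y₂ → y₂ - ((x₀ * y₂ - y₀ * x₂) * y₁ - y₀)
             ≡ (- y₂) * (x₀ * y₁ - y₀ * x₁ - + 1) + (- y₀) * (x₁ * y₂ - y₁ * x₂ - + 1)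
        id = solve-∀

      p-path : path (+ 0) (+ 0) ⟦ residue (p 1) ⟧ cs ~ p
      p-path = path-coefficients k p y p (≈-sym p-first) (⟦residue⟧ (p 1)) (≈-sym p-last) p-rec

      endpoint≈ : endpoint (+ 0) ⟦ residue (p 1) ⟧ cs ≈ p (suc k)
      endpoint≈ = ≈-trans (≈-reflexive (sym (path-endpoint (+ 0) (+ 0) ⟦ residue (p 1) ⟧ cs))) (p-path (suc k) (ℕ.n≤1+n _))

      valid : Valid (datumOf k p q)
      valid = Unit-resp (≈-sym (⟦residue⟧ (p 1))) (inverse⇒unit {p 1} {q 1} first-inverse)
            , Unit-resp (≈-sym endpoint≈) (inverse⇒unit {p (suc k)} {q (suc k)} last-inverse)

      inverse-cong : ∀ {a a′ b c} → a ≈ a′ → a * b ≈ + 1 → a′ * c ≈ + 1 → b ≈ c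
      inverse-cong {a} {a′} {b} {c} e f g = lincomb₃ (- (b * c)) c (- b) e f g (id a a′ b c)
        where
        id : ∀ a a′ b c → b - c ≡ (- (b * c)) * (a - a′) + c * (a * b - + 1) + (- b) * (a′ * c - + 1)
        id = solve-∀

      module _ (valid : Valid (datumOf k p q)) where
        open FromData (residue (p 1)) cs valid using (ē; f) renaming (q to q′; y to y′)

        y′≈y : ∀ i → i ℕ.≤ 2 ℕ.+ k → y′ i ≈ y i
        y′≈y = path-coefficients k p y y
          (lincomb₁ (- + 1) ē≈ (neg ⟦ ē ⟧ (q 1)))
          (≈-sym q-first)
          (inverse-cong endpoint≈ (proj₂ (proj₂ valid)) last-inverse)
          y-rec
          where
          neg : ∀ a b → (- a) - (- b) ≡ (- + 1) * (a - b)
          neg = solve-∀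
          ē≈ : ⟦ ē ⟧ ≈ q 1
          ē≈ = inverse-cong (⟦residue⟧ (p 1)) (proj₂ (proj₁ valid)) first-inverse

        q′~q : q′ ~ q
        q′~q i i≤ with ℕ.m≤n⇒m<n∨m≡n i≤
        ... | inj₁ i<   = y′≈y (suc i) i<
        ... | inj₂ refl = ≈-trans (≈-reflexive (path-beyond ⟦ f ⟧ (- ⟦ ē ⟧) (+ 0) cs)) (≈-sym q-last)

    datum-valid : ∀ F → Valid (datum F)
    datum-valid F = ToData.valid (Evaluate.r-adjacent F (+ 0))

    -- Stated for an arbitrary validity proof, since the enumeration supplies its own; the inverses
    -- stored in it agree with entries of F by uniqueness of inverses.
    frieze-datum : ∀ F (valid : Valid (datum F)) → frieze (datum F) valid ≈F F
    frieze-datum F valid u i = trans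
      (residue-cong (≈-trans (friezeRows-unique (FromData.adjacent (residue (p 1)) (coefficients p (prepend q) k) valid)
                               (Evaluate.friezeRows F)
                               (ToData.p-path a) (ToData.q′~q a valid) u (toℕ i) (ℕ.≤-pred (Fin.toℕ<n i)))
                             (≈-reflexive (rowOf-toℕ (TameFrieze.E F) u i))))
      (residue-⟦⟧ (TameFrieze.E F u i))
      where
      p q : Row
      p = rowOf (TameFrieze.E F) (+ 0)
      q = rowOf (TameFrieze.E F) (+ 1)
      a : Adjacent p q
      a = Evaluate.r-adjacent F (+ 0)

  -- Enumeration of the valid data

  allVecs : ∀ j → List (Vec (Fin n) j)
  allVecs zero    = [] ∷ []
  allVecs (suc j) = cartesianProductWith _∷_ (allFin n) (allVecs j)

  allVecs-unique : ∀ j → Unique (allVecs j)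
  allVecs-unique zero    = [] ∷ []
  allVecs-unique (suc j) =
    Unique.cartesianProductWith⁺ _∷_ (λ { refl → refl , refl }) (Unique.allFin⁺ n) (allVecs-unique j)

  ∈-allVecs : ∀ {j} (v : Vec (Fin n) j) → v ∈ allVecs j
  ∈-allVecs []      = here refl
  ∈-allVecs (c ∷ v) = ∈-cartesianProductWith⁺ _∷_ (∈-allFin c) (∈-allVecs v)

  validVecs : ∀ k → List (Vec (Fin n) (suc k))
  validVecs k = filter (valid? {k}) (allVecs (suc k))

  -- A frieze is sent to the position of its datum. The list has no repetitions, so membership
  -- proofs are unique and the position depends on the datum alone.
  friezes-counted : ∀ k → HasCardinality (TameFrieze n (2 ℕ.+ k)) _≈F_ (length (validVecs k))
  friezes-counted k = record
    { to      = λ F → index (mem F)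
    ; from    = fromIndex
    ; to-cong = λ {F} {G} eq → index-cong (mem F) (mem G) (datum-cong k {F} {G} eq)
    ; from-to = from-to
    ; to-from = λ i → trans
        (index-cong (mem (fromIndex i)) (∈-lookup i) (datum-frieze k (lookup xs i) (valid i)))
        (index-∈-lookup xs i)
    }
    where
    xs = validVecs k
    mem : ∀ F → datum k F ∈ xs
    mem F = ∈-filter⁺ (valid? {k}) (∈-allVecs (datum k F)) (datum-valid k F)
    valid : ∀ i → Valid (lookup xs i)
    valid i = proj₂ (∈-filter⁻ (valid? {k}) {xs = allVecs (suc k)} (∈-lookup i))
    fromIndex : Fin (length xs) → TameFrieze n (2 ℕ.+ k)
    fromIndex i = frieze k (lookup xs i) (valid i)
    index-cong : ∀ {v w} (p : v ∈ xs) (q : w ∈ xs) → v ≡ w → index p ≡ index q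
    index-cong p q refl = cong index (unique⇒irrelevant (Unique.filter⁺ (valid? {k}) (allVecs-unique (suc k))) p q)
    index-∈-lookup : ∀ {A : Set} (xs : List A) i → index (∈-lookup {xs = xs} i) ≡ i
    index-∈-lookup (x ∷ xs) Fin.zero    = refl
    index-∈-lookup (x ∷ xs) (Fin.suc i) = cong Fin.suc (index-∈-lookup xs i)
    from-to : ∀ F → fromIndex (index (mem F)) ≈F F
    from-to F = go (lookup xs (index (mem F))) (sym (lookup-index (mem F))) (valid (index (mem F)))
      where
      go : ∀ v → v ≡ datum k F → (va : Valid v) → frieze k v va ≈F F
      go v refl va = frieze-datum k F va

-- Finite sums

sumTo : ℕ → (ℕ → ℕ) → ℕ
sumTo zero    f = 0
sumTo (suc n) f = f 0 ℕ.+ sumTo n (f ∘ suc)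

sumTo-cong : ∀ n {f g} → (∀ i → i ℕ.< n → f i ≡ g i) → sumTo n f ≡ sumTo n g
sumTo-cong zero    eq = refl
sumTo-cong (suc n) eq = cong₂ ℕ._+_ (eq 0 (s≤s z≤n)) (sumTo-cong n (λ i i<n → eq (suc i) (s≤s i<n)))

sumTo-+ : ∀ n f g → sumTo n (λ i → f i ℕ.+ g i) ≡ sumTo n f ℕ.+ sumTo n g
sumTo-+ zero    f g = refl
sumTo-+ (suc n) f g = trans (cong (f 0 ℕ.+ g 0 ℕ.+_) (sumTo-+ n (f ∘ suc) (g ∘ suc)))
  (interchange (f 0) (g 0) (sumTo n (f ∘ suc)) (sumTo n (g ∘ suc)))
  where
  interchange : ∀ a b c d → (a ℕ.+ b) ℕ.+ (c ℕ.+ d) ≡ (a ℕ.+ c) ℕ.+ (b ℕ.+ d)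
  interchange = ℕ-solver.solve-∀

sumTo-*ˡ : ∀ n c f → sumTo n (λ i → c ℕ.* f i) ≡ c ℕ.* sumTo n f
sumTo-*ˡ zero    c f = sym (ℕ.*-zeroʳ c)
sumTo-*ˡ (suc n) c f = trans (cong (c ℕ.* f 0 ℕ.+_) (sumTo-*ˡ n c (f ∘ suc)))
  (sym (ℕ.*-distribˡ-+ c (f 0) (sumTo n (f ∘ suc))))

sumTo-*ʳ : ∀ n c f → sumTo n (λ i → f i ℕ.* c) ≡ sumTo n f ℕ.* c
sumTo-*ʳ n c f = trans (sumTo-cong n (λ i _ → ℕ.*-comm (f i) c))
  (trans (sumTo-*ˡ n c f) (ℕ.*-comm c (sumTo n f)))

sumTo-const : ∀ n c → sumTo n (λ _ → c) ≡ n ℕ.* c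
sumTo-const zero    c = refl
sumTo-const (suc n) c = cong (c ℕ.+_) (sumTo-const n c)

sumTo-split : ∀ m n f → sumTo (m ℕ.+ n) f ≡ sumTo m f ℕ.+ sumTo n (λ i → f (m ℕ.+ i))
sumTo-split zero    n f = refl
sumTo-split (suc m) n f = trans (cong (f 0 ℕ.+_) (sumTo-split m n (f ∘ suc)))
  (sym (ℕ.+-assoc (f 0) (sumTo m (f ∘ suc)) (sumTo n (λ i → f (suc (m ℕ.+ i))))))

sumTo-swap : ∀ m n (f : ℕ → ℕ → ℕ) → sumTo m (λ i → sumTo n (f i)) ≡ sumTo n (λ j → sumTo m (λ i → f i j))
sumTo-swap zero    n f = sym (trans (sumTo-const n 0) (ℕ.*-zeroʳ n))
sumTo-swap (suc m) n f = trans (cong (sumTo n (f 0) ℕ.+_) (sumTo-swap m n (f ∘ suc)))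
  (sym (sumTo-+ n (f 0) (λ j → sumTo m (λ i → f (suc i) j))))

sumTo-blocks : ∀ m n f → sumTo (m ℕ.* n) f ≡ sumTo m (λ j → sumTo n (λ i → f (j ℕ.* n ℕ.+ i)))
sumTo-blocks zero    n f = refl
sumTo-blocks (suc m) n f = trans (sumTo-split n (m ℕ.* n) f) (cong (sumTo n f ℕ.+_)
  (trans (sumTo-blocks m n (λ i → f (n ℕ.+ i)))
    (sumTo-cong m (λ j _ → sumTo-cong n (λ i _ → cong f (sym (ℕ.+-assoc n (j ℕ.* n) i)))))))

-- Sums indexed by ℕ are easy to cut into blocks; this passage to `Fin` makes invariance under
-- permutations available.
sumTo-Fin : ∀ n f → sumTo n f ≡ Sum.sum {n} (f ∘ toℕ)
sumTo-Fin zero    f = refl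
sumTo-Fin (suc n) f = cong (f 0 ℕ.+_) (sumTo-Fin n (f ∘ suc))

sum-allFin : ∀ n (f : ℕ → ℕ) → sum (map (f ∘ toℕ) (allFin n)) ≡ sumTo n f
sum-allFin n f = trans (cong sum (List.map-tabulate {n = n} Function.id (f ∘ toℕ))) (go n f)
  where
  go : ∀ n (f : ℕ → ℕ) → sum (tabulate {n = n} (f ∘ toℕ)) ≡ sumTo n f
  go zero    f = refl
  go (suc n) f = cong (f 0 ℕ.+_) (go n (f ∘ suc))

product-map-cong : ∀ {f g : ℕ → ℕ} L → (∀ p → p ∈ L → f p ≡ g p) → product (map f L) ≡ product (map g L)
product-map-cong L eq = cong product (List.map-cong-local (All.tabulate (eq _)))

product-map-* : ∀ (f g : ℕ → ℕ) L → product (map (λ p → f p ℕ.* g p) L) ≡ product (map f L) ℕ.* product (map g L)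
product-map-* f g []      = refl
product-map-* f g (p ∷ L) = trans (cong (f p ℕ.* g p ℕ.*_) (product-map-* f g L))
  (interchange (f p) (g p) (product (map f L)) (product (map g L)))
  where
  interchange : ∀ a b c d → (a ℕ.* b) ℕ.* (c ℕ.* d) ≡ (a ℕ.* c) ℕ.* (b ℕ.* d)
  interchange = ℕ-solver.solve-∀

product-map-1 : ∀ {A : Set} (L : List A) → product (map (λ _ → 1) L) ≡ 1
product-map-1 []      = refl
product-map-1 (_ ∷ L) = trans (ℕ.+-identityʳ _) (product-map-1 L)

product-map-0 : ∀ {f : ℕ → ℕ} {L p} → p ∈ L → f p ≡ 0 → product (map f L) ≡ 0
product-map-0 {f} {q ∷ L} (here refl) eq = cong (ℕ._* product (map f L)) eq
product-map-0 {f} {q ∷ L} (there p∈L) eq = trans (cong (f q ℕ.*_) (product-map-0 p∈L eq)) (ℕ.*-zeroʳ (f q))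

-- Sums of periodic functions

Periodic : ℕ → (ℤ → ℕ) → Set
Periodic n f = ∀ {a b} → Modular._≈_ n a b → f a ≡ f b

≈-∣ : ∀ {m n a b} → m ∣ n → Modular._≈_ n a b → Modular._≈_ m a b
≈-∣ {m} {n} (divides q refl) (Modular.congruent r eq) =
  Modular.congruent (r * + q) (trans eq (trans (cong (r *_) (ℤ.pos-* q m)) (sym (ℤ.*-assoc r (+ q) (+ m)))))

abs-associate : ∀ a → ∃ λ s → + ∣ a ∣ ≡ a * s
abs-associate (+ n)    = + 1 , sym (ℤ.*-identityʳ (+ n))
abs-associate -[1+ n ] = - + 1 , trans (sym (ℤ.neg-involutive (+ suc n))) (neg (- + suc n))
  where
  neg : ∀ a → - a ≡ a * (- + 1)
  neg = solve-∀

coprime⇒invertible : ∀ {n a} → Coprime ∣ a ∣ n → ∃ λ b → Modular._≈_ n (a * b) (+ 1)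
coprime⇒invertible {n} {a} c with abs-associate a | coprime-Bézout c
... | s , eq | Bézout.+- x y bez = s * + x , Modular.congruent (+ y) (trans (cong (_- + 1) lem) (cancel (+ y * + n)))
  where
  assoc : ∀ a s x → a * (s * x) ≡ x * (a * s)
  assoc = solve-∀
  cancel : ∀ x → + 1 + x - + 1 ≡ x
  cancel = solve-∀
  lem : a * (s * + x) ≡ + 1 + + y * + n
  lem = trans (assoc a s (+ x)) (trans (cong (+ x *_) (sym eq))
    (trans (sym (ℤ.pos-* x ∣ a ∣)) (trans (cong +_ (sym bez)) (cong (λ z → + 1 + z) (ℤ.pos-* y n)))))
... | s , eq | Bézout.-+ x y bez = s * (- + x) , Modular.congruent (- + y)
  (trans (rearrange a s (+ x)) (trans (cong -_ lem) (ℤ.neg-distribˡ-* (+ y) (+ n))))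
  where
  rearrange : ∀ a s x → a * (s * (- x)) - + 1 ≡ - (+ 1 + x * (a * s))
  rearrange = solve-∀
  lem : + 1 + + x * (a * s) ≡ + y * + n
  lem = trans (cong (λ z → + 1 + + x * z) (sym eq))
    (trans (cong (λ z → + 1 + z) (sym (ℤ.pos-* x ∣ a ∣))) (trans (cong +_ bez) (ℤ.pos-* y n)))

invertible⇒coprime : ∀ {n a b} → Modular._≈_ n (a * b) (+ 1) → Coprime ∣ a ∣ n
invertible⇒coprime {n} {a} {b} ab≈1 {d} (d∣a , d∣n) = ∣.∣1⇒≡1 (≈⇒≅ 1≈0)
  where
  open Modular d
  a≈0 : a ≈ + 0
  a≈0 = ≅⇒≈ (subst (λ z → d ∣ ∣ z ∣) (sym (ℤ.+-identityʳ a)) d∣a)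
  1≈0 : + 1 ≈ + 0
  1≈0 = lincomb₂ (- + 1) b (≈-∣ d∣n ab≈1) a≈0 (id a b)
    where
    id : ∀ a b → + 1 - + 0 ≡ (- + 1) * (a * b - + 1) + b * (a - + 0)
    id = solve-∀

prime⇒coprime : ∀ {p m} → Prime p → ¬ p ∣ m → Coprime m p
prime⇒coprime {p} {m} pp p∤m (d∣m , d∣p) with prime⇒irreducible pp d∣p
... | inj₁ d≡1  = d≡1
... | inj₂ refl = contradiction d∣m p∤m

-- Multiplication by a unit followed by a translation permutes the residues modulo n.
sumTo-affine : ∀ n .{{_ : NonZero n}} {f u v} t → Periodic n f → Modular._≈_ n (u * v) (+ 1) →
               sumTo n (λ i → f (+ i * u + t)) ≡ sumTo n (λ i → f (+ i))
sumTo-affine n {f} {u} {v} t per inv =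
  trans (sumTo-Fin n (λ i → f (+ i * u + t)))
    (trans (Sum.sum-cong-≗ {n} (λ i → per (≈-sym (⟦residue⟧ (⟦ i ⟧ * u + t)))))
      (sym (trans (sumTo-Fin n (λ i → f (+ i))) (Sum.sum-permute {n} (λ i → f ⟦ i ⟧) π))))
  where
  open Modular n
  open Residue
  fwd bwd : Fin n → Fin n
  fwd i = residue (⟦ i ⟧ * u + t)
  bwd i = residue ((⟦ i ⟧ - t) * v)
  fwd-bwd : ∀ i → fwd (bwd i) ≡ i
  fwd-bwd i = ⟦⟧-injective (≈-trans (⟦residue⟧ (⟦ bwd i ⟧ * u + t))
    (lincomb₂ u (⟦ i ⟧ - t) (⟦residue⟧ ((⟦ i ⟧ - t) * v)) inv (id ⟦ bwd i ⟧ ⟦ i ⟧ t u v)))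
    where
    id : ∀ b i t u v → b * u + t - i ≡ u * (b - (i - t) * v) + (i - t) * (u * v - + 1)
    id = solve-∀
  bwd-fwd : ∀ i → bwd (fwd i) ≡ i
  bwd-fwd i = ⟦⟧-injective (≈-trans (⟦residue⟧ ((⟦ fwd i ⟧ - t) * v))
    (lincomb₂ v ⟦ i ⟧ (⟦residue⟧ (⟦ i ⟧ * u + t)) inv (id ⟦ fwd i ⟧ ⟦ i ⟧ t u v)))
    where
    id : ∀ b i t u v → (b - t) * v - i ≡ v * (b - (i * u + t)) + i * (u * v - + 1)
    id = solve-∀
  π = permutation fwd bwd fwd-bwd bwd-fwd

sumTo-multiple : ∀ c n {f} → Periodic n f → sumTo (c ℕ.* n) (λ i → f (+ i)) ≡ c ℕ.* sumTo n (λ i → f (+ i))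
sumTo-multiple c n {f} per = trans (sumTo-blocks c n (λ i → f (+ i)))
  (trans (sumTo-cong c (λ j _ → sumTo-cong n (λ i _ → per (shift j i)))) (sumTo-const c (sumTo n (λ i → f (+ i)))))
  where
  open Modular n
  shift : ∀ j i → + (j ℕ.* n ℕ.+ i) ≈ + i
  shift j i = congruent (+ j) (trans (cong (λ z → z + + i - + i) (ℤ.pos-* j n)) (cancel (+ j * + n) (+ i)))
    where
    cancel : ∀ a b → a + b - b ≡ a
    cancel = solve-∀

product-periodic : ∀ (h : ℕ → ℤ → ℕ) → (∀ p → Periodic p (h p)) →
                   ∀ L → Periodic (product L) (λ a → product (map (λ p → h p a) L))
product-periodic h per L a≈b = product-map-cong L (λ p p∈L → per p (≈-∣ (∈⇒∣product p∈L) a≈b))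

coprime-product : ∀ {p L} → Prime p → All Prime L → All (λ q → ¬ p ≡ q) L → Coprime p (product L)
coprime-product pp primes distinct = Coprime.sym (prime⇒coprime pp (λ p∣ΠL →
  All.lookup distinct (factorisationHasAllPrimeFactors pp p∣ΠL primes) refl))

-- With N the product of the remaining primes, the range is cut into N blocks of length p. For a
-- fixed position i in a block, the numbers j p + i with j < N run through all residues modulo N, as
-- p is invertible there; hence the sum of the other factors does not depend on i.
sumTo-chineseRemainder : ∀ (h : ℕ → ℤ → ℕ) → (∀ p → Periodic p (h p)) →
  ∀ {L} → All Prime L → Unique L →
  sumTo (product L) (λ i → product (map (λ p → h p (+ i)) L)) ≡ product (map (λ p → sumTo p (λ i → h p (+ i))) L)
sumTo-chineseRemainder h per {[]} [] [] = refl
sumTo-chineseRemainder h per {p ∷ L} (pp ∷ primes) (distinct ∷ unique) = begin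
  sumTo (p ℕ.* N) F
    ≡⟨ cong (λ m → sumTo m F) (ℕ.*-comm p N) ⟩
  sumTo (N ℕ.* p) F
    ≡⟨ sumTo-blocks N p F ⟩
  sumTo N (λ j → sumTo p (λ i → F (j ℕ.* p ℕ.+ i)))
    ≡⟨ sumTo-swap N p (λ j i → F (j ℕ.* p ℕ.+ i)) ⟩
  sumTo p (λ i → sumTo N (λ j → F (j ℕ.* p ℕ.+ i)))
    ≡⟨ sumTo-cong p (λ i _ → inner i) ⟩
  sumTo p (λ i → h p (+ i) ℕ.* sumTo N (λ j → H (+ j)))
    ≡⟨ sumTo-*ʳ p (sumTo N (λ j → H (+ j))) (λ i → h p (+ i)) ⟩
  sumTo p (λ i → h p (+ i)) ℕ.* sumTo N (λ j → H (+ j))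
    ≡⟨ cong (sumTo p (λ i → h p (+ i)) ℕ.*_) (sumTo-chineseRemainder h per primes unique) ⟩
  sumTo p (λ i → h p (+ i)) ℕ.* product (map (λ q → sumTo q (λ i → h q (+ i))) L) ∎
  where
  open ≡-Reasoning
  N : ℕ
  N = product L
  instance
    N≢0 : NonZero N
    N≢0 = productOfPrimes≢0 primes
  H : ℤ → ℕ
  H a = product (map (λ q → h q a) L)
  F : ℕ → ℕ
  F i = h p (+ i) ℕ.* H (+ i)
  pos : ∀ j i → + (j ℕ.* p ℕ.+ i) ≡ + j * + p + + i
  pos j i = cong (_+ + i) (ℤ.pos-* j p)
  shift : ∀ j i → Modular._≈_ p (+ (j ℕ.* p ℕ.+ i)) (+ i)
  shift j i = Modular.congruent (+ j) (trans (cong (_- + i) (pos j i)) (cancel (+ j * + p) (+ i)))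
    where
    cancel : ∀ a b → a + b - b ≡ a
    cancel = solve-∀
  inner : ∀ i → sumTo N (λ j → F (j ℕ.* p ℕ.+ i)) ≡ h p (+ i) ℕ.* sumTo N (λ j → H (+ j))
  inner i = trans
    (sumTo-cong N (λ j _ → cong₂ ℕ._*_ (per p (shift j i)) (cong H (pos j i))))
    (trans (sumTo-*ˡ N (h p (+ i)) (λ j → H (+ j * + p + + i)))
      (cong (h p (+ i) ℕ.*_)
        (sumTo-affine N (+ i) (product-periodic h per L)
          (proj₂ (coprime⇒invertible {N} {+ p} (coprime-product pp primes distinct))))))

-- Counting quiddity data

-- The number of coefficient sequences of length k modulo p along which the recurrence ends in a
-- nonzero value, when the current value is nonzero (α) or zero (β).
α β : ℕ → ℕ → ℕ
α p zero    = 1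
α p (suc k) = β p k ℕ.+ (p ∸ 1) ℕ.* α p k
β p zero    = 0
β p (suc k) = p ℕ.* α p k

-- The number of continuations modulo p from a current value a. At k = 0 it is the indicator of a
-- being nonzero modulo p.
weight : ℕ → ℕ → ℤ → ℕ
weight p k a = if does (Modular._≈?_ p a (+ 0)) then β p k else α p k

module _ {p k : ℕ} where
  open Modular p

  weight-zero : ∀ {a} → a ≈ + 0 → weight p k a ≡ β p k
  weight-zero {a} a≈0 rewrite dec-true (a ≈? + 0) a≈0 = refl

  weight-nonzero : ∀ {a} → ¬ a ≈ + 0 → weight p k a ≡ α p k
  weight-nonzero {a} a≉0 rewrite dec-false (a ≈? + 0) a≉0 = refl

  weight-periodic : Periodic p (weight p k)
  weight-periodic {a} {b} a≈b with b ≈? + 0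
  ... | yes b≈0 = trans (weight-zero (≈-trans a≈b b≈0)) (sym (weight-zero b≈0))
  ... | no b≉0  = trans (weight-nonzero (λ a≈0 → b≉0 (≈-trans (≈-sym a≈b) a≈0))) (sym (weight-nonzero b≉0))

≈0⇒∣ : ∀ {p a} → Modular._≈_ p a (+ 0) → p ∣ ∣ a ∣
≈0⇒∣ {p} {a} a≈0 = subst (λ z → p ∣ ∣ z ∣) (ℤ.+-identityʳ a) (Modular.≈⇒≅ p a≈0)

∣⇒≈0 : ∀ {p a} → p ∣ ∣ a ∣ → Modular._≈_ p a (+ 0)
∣⇒≈0 {p} {a} p∣a = Modular.≅⇒≈ p (subst (λ z → p ∣ ∣ z ∣) (sym (ℤ.+-identityʳ a)) p∣a)

-- One residue is zero and p - 1 are not, which is the recursion for `α`. At k = 0 the sum counts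
-- the units modulo p.
sumTo-weight-residues : ∀ {p} k → .{{NonZero p}} → sumTo p (λ i → weight p k (+ i)) ≡ α p (suc k)
sumTo-weight-residues {suc p} k = cong₂ ℕ._+_ (weight-zero {suc p} {k} ≈-refl)
  (trans (sumTo-cong p (λ i i<p → weight-nonzero {suc p} {k} {+ suc i} (λ i≈0 →
            contradiction (∣⇒≤ (≈0⇒∣ {suc p} {+ suc i} i≈0)) (ℕ.<⇒≱ (s≤s i<p)))))
         (sumTo-const p (α (suc p) k)))
  where open Modular (suc p)

-- Here x is the previous and y the current value. If p does not divide y, then i ↦ i y - x permutes
-- the residues; otherwise its value is always -x, nonzero by hypothesis.
sumTo-weight : ∀ {p} k x y → Prime p → ¬ (Modular._≈_ p x (+ 0) × Modular._≈_ p y (+ 0)) →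
               sumTo p (λ i → weight p k (+ i * y - x)) ≡ weight p (suc k) y
sumTo-weight {p} k x y pp xy≉0 with Modular._≈?_ p y (+ 0)
... | yes y≈0 = trans (sumTo-cong p (λ i _ → weight-nonzero {p} {k} (λ z≈0 → xy≉0 (x≈0 i z≈0 , y≈0))))
                      (trans (sumTo-const p (α p k)) (sym (weight-zero {p} {suc k} y≈0)))
  where
  open Modular p
  x≈0 : ∀ i → + i * y - x ≈ + 0 → x ≈ + 0
  x≈0 i z≈0 = lincomb₂ (+ i) (- + 1) y≈0 z≈0 (id (+ i) x y)
    where
    id : ∀ i x y → x - + 0 ≡ i * (y - + 0) + (- + 1) * (i * y - x - + 0)
    id = solve-∀
... | no y≉0 = trans
  (sumTo-affine p (- x) (weight-periodic {p} {k})
    (proj₂ (coprime⇒invertible {p} {y} (prime⇒coprime pp (λ p∣y → y≉0 (∣⇒≈0 p∣y))))))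
  (trans (sumTo-weight-residues k) (sym (weight-nonzero {p} {suc k} y≉0)))
  where
  instance
    p≢0 : NonZero p
    p≢0 = prime⇒nonZero pp

indicator : ∀ {P : Set} → Dec P → ℕ
indicator d = if does d then 1 else 0

length-filter≡sum : ∀ {A : Set} {P : A → Set} (P? : Decidable P) xs →
                length (filter P? xs) ≡ sum (map (indicator ∘ P?) xs)
length-filter≡sum P? []       = refl
length-filter≡sum P? (x ∷ xs) with does (P? x)
... | true  = cong suc (length-filter≡sum P? xs)
... | false = length-filter≡sum P? xs

sum-cartesianProductWith : ∀ {A B C : Set} (f : C → ℕ) (g : A → B → C) xs ys →
  sum (map f (cartesianProductWith g xs ys)) ≡ sum (map (λ x → sum (map (λ y → f (g x y)) ys)) xs)
sum-cartesianProductWith f g []       ys = refl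
sum-cartesianProductWith f g (x ∷ xs) ys = trans
  (cong sum (List.map-++ f (map (g x) ys) (cartesianProductWith g xs ys)))
  (trans (sum-++ (map f (map (g x) ys)) (map f (cartesianProductWith g xs ys)))
    (cong₂ ℕ._+_ (cong sum (sym (List.map-∘ ys))) (sum-cartesianProductWith f g xs ys)))

sum-map-cong : ∀ {A : Set} {f g : A → ℕ} xs → (∀ x → f x ≡ g x) → sum (map f xs) ≡ sum (map g xs)
sum-map-cong xs eq = cong sum (List.map-cong eq xs)

sum-map-*ˡ : ∀ {A : Set} c (f : A → ℕ) xs → sum (map (λ x → c ℕ.* f x) xs) ≡ c ℕ.* sum (map f xs)
sum-map-*ˡ c f []       = sym (ℕ.*-zeroʳ c)
sum-map-*ˡ c f (x ∷ xs) = trans (cong (c ℕ.* f x ℕ.+_) (sum-map-*ˡ c f xs))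
  (sym (ℕ.*-distribˡ-+ c (f x) (sum (map f xs))))

∃-prime-divisor : ∀ g → .{{NonZero g}} → ¬ g ≡ 1 → ∃ λ p → Prime p × p ∣ g
∃-prime-divisor g g≢1 with factorise g
... | record { factors = [] ; isFactorisation = eq } = contradiction eq g≢1
... | record { factors = p ∷ ps ; isFactorisation = eq ; factorsPrime = pp ∷ _ } =
  p , pp , subst (p ∣_) (sym eq) (∈⇒∣product {p} {p ∷ ps} (here refl))

-- Here `product L` is the radical of n, and `c` is the number of residues modulo n above each
-- residue modulo the radical.
module Counting
  (n c : ℕ) (L : List ℕ) .{{n≢0 : NonZero n}}
  (primes : All Prime L) (unique : Unique L)
  (L-complete : ∀ {p} → Prime p → p ∣ n → p ∈ L) (n≡c*ΠL : n ≡ c ℕ.* product L)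
  where
  open Modular n using (⟦_⟧)
  open Quiddity n

  L-divides : ∀ {p} → p ∈ L → p ∣ n
  L-divides p∈L = ∣.∣-trans (∈⇒∣product p∈L) (divides c n≡c*ΠL)

  sumTo-product : ∀ (h : ℕ → ℤ → ℕ) → (∀ p → Periodic p (h p)) →
    sumTo n (λ i → product (map (λ p → h p (+ i)) L)) ≡ c ℕ.* product (map (λ p → sumTo p (λ i → h p (+ i))) L)
  sumTo-product h per = trans (cong (λ m → sumTo m (λ i → product (map (λ p → h p (+ i)) L))) n≡c*ΠL)
    (trans (sumTo-multiple c (product L) (product-periodic h per L))
           (cong (c ℕ.*_) (sumTo-chineseRemainder h per primes unique)))

  unit-coprime : ∀ {p a} → Prime p → p ∈ L → Unit a → ¬ Modular._≈_ p a (+ 0)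
  unit-coprime {p} {a} pp p∈L (b , ab≈1) a≈0 =
    ℕ.nonTrivial⇒≢1 {{prime⇒nonTrivial pp}}
      (invertible⇒coprime {n} {a} {⟦ b ⟧} ab≈1 (≈0⇒∣ a≈0 , L-divides p∈L))

  -- A unit modulo n is nonzero modulo every prime in L. For a non-unit, a prime divisor of gcd(|a|,
  -- n) yields a zero factor.
  indicator-unit : ∀ a → indicator (unit? a) ≡ product (map (λ p → weight p 0 a) L)
  indicator-unit a with unit? a
  ... | yes u = sym (trans
          (product-map-cong L (λ p p∈L → weight-nonzero {p} {0} {a} (unit-coprime {p} {a} (All.lookup primes p∈L) p∈L u)))
          (product-map-1 L))
  ... | no ¬u = sym (product-map-0 p∈L (weight-zero {p} {0} (∣⇒≈0 {p} {a} (∣.∣-trans p∣g (gcd[m,n]∣m ∣ a ∣ n)))))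
    where
    g : ℕ
    g = gcd ∣ a ∣ n
    instance
      g≢0 : NonZero g
      g≢0 = ℕ.≢-nonZero (gcd[m,n]≢0 ∣ a ∣ n (inj₂ (ℕ.≢-nonZero⁻¹ n)))
    g≢1 : ¬ g ≡ 1
    g≢1 g≡1 = ¬u (inverse⇒unit {a} (proj₂ (coprime⇒invertible {n} {a} (Coprime.gcd≡1⇒coprime g≡1))))
    p : ℕ
    p = proj₁ (∃-prime-divisor g g≢1)
    p∣g : p ∣ g
    p∣g = proj₂ (proj₂ (∃-prime-divisor g g≢1))
    p∈L : p ∈ L
    p∈L = L-complete (proj₁ (proj₂ (∃-prime-divisor g g≢1))) (∣.∣-trans p∣g (gcd[m,n]∣n ∣ a ∣ n))

  -- Summing out the first coefficient raises the index of every weight by one and contributes one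
  -- factor c. The hypothesis passes to the next state because x is recovered from y and i y - x.
  sum-endpoint : ∀ k x y → (∀ p → p ∈ L → ¬ (Modular._≈_ p x (+ 0) × Modular._≈_ p y (+ 0))) →
    sum (map (λ cs → product (map (λ p → weight p 0 (endpoint x y cs)) L)) (allVecs k))
      ≡ c ^ k ℕ.* product (map (λ p → weight p k y) L)
  sum-endpoint zero    x y xy = refl
  sum-endpoint (suc k) x y xy = begin
    sum (map f (allVecs (suc k)))
      ≡⟨ sum-cartesianProductWith f _∷_ (allFin n) (allVecs k) ⟩
    sum (map (λ i → sum (map (λ cs → f (i ∷ cs)) (allVecs k))) (allFin n))
      ≡⟨ sum-map-cong (allFin n) (λ i → sum-endpoint k y (advance x y i) (λ p p∈L → carry p p∈L i)) ⟩
    sum (map (λ i → c ^ k ℕ.* W (⟦ i ⟧ * y - x)) (allFin n))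
      ≡⟨ sum-allFin n (λ i → c ^ k ℕ.* W (+ i * y - x)) ⟩
    sumTo n (λ i → c ^ k ℕ.* W (+ i * y - x))
      ≡⟨ sumTo-*ˡ n (c ^ k) (λ i → W (+ i * y - x)) ⟩
    c ^ k ℕ.* sumTo n (λ i → W (+ i * y - x))
      ≡⟨ cong (c ^ k ℕ.*_) (sumTo-product (λ p a → weight p k (a * y - x)) per) ⟩
    c ^ k ℕ.* (c ℕ.* product (map (λ p → sumTo p (λ i → weight p k (+ i * y - x))) L))
      ≡⟨ cong (λ z → c ^ k ℕ.* (c ℕ.* z))
           (product-map-cong L (λ p p∈L → sumTo-weight k x y (All.lookup primes p∈L) (xy p p∈L))) ⟩
    c ^ k ℕ.* (c ℕ.* product (map (λ p → weight p (suc k) y) L))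
      ≡⟨ regroup (c ^ k) c (product (map (λ p → weight p (suc k) y) L)) ⟩
    c ^ suc k ℕ.* product (map (λ p → weight p (suc k) y) L) ∎
    where
    open ≡-Reasoning
    f : Vec (Fin n) (suc k) → ℕ
    f cs = product (map (λ p → weight p 0 (endpoint x y cs)) L)
    W : ℤ → ℕ
    W a = product (map (λ p → weight p k a) L)
    regroup : ∀ a b d → a ℕ.* (b ℕ.* d) ≡ (b ℕ.* a) ℕ.* d
    regroup = ℕ-solver.solve-∀
    carry : ∀ p → p ∈ L → ∀ i → ¬ (Modular._≈_ p y (+ 0) × Modular._≈_ p (advance x y i) (+ 0))
    carry p p∈L i (y≈0 , z≈0) = xy p p∈L
      (Modular.lincomb₂ p ⟦ i ⟧ (- + 1) y≈0 z≈0 (id ⟦ i ⟧ x y) , y≈0)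
      where
      id : ∀ i x y → x - + 0 ≡ i * (y - + 0) + (- + 1) * (i * y - x - + 0)
      id = solve-∀
    per : ∀ p → Periodic p (λ a → weight p k (a * y - x))
    per p a≈b = weight-periodic {p} {k} (-‿cong (*-cong a≈b (≈-refl {y})) (≈-refl {x}))
      where open Modular p

  -- The k coefficients and the starting value give k + 1 factors c; α p 1 counts the starting
  -- values modulo p.
  length-validVecs : ∀ k → length (validVecs k) ≡
    c ^ suc k ℕ.* product (map (λ p → α p 1 ℕ.* α p k) L)
  length-validVecs k = begin
    length (validVecs k)
      ≡⟨ length-filter≡sum (valid? {k}) (allVecs (suc k)) ⟩
    sum (map (indicator ∘ valid? {k}) (allVecs (suc k)))
      ≡⟨ sum-cartesianProductWith (indicator ∘ valid? {k}) _∷_ (allFin n) (allVecs k) ⟩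
    sum (map (λ e → sum (map (λ cs → indicator (valid? (e ∷ cs))) (allVecs k))) (allFin n))
      ≡⟨ sum-map-cong (allFin n) fibre ⟩
    sum (map (λ e → A ℕ.* product (map (λ p → weight p 0 ⟦ e ⟧) L)) (allFin n))
      ≡⟨ sum-allFin n (λ i → A ℕ.* product (map (λ p → weight p 0 (+ i)) L)) ⟩
    sumTo n (λ i → A ℕ.* product (map (λ p → weight p 0 (+ i)) L))
      ≡⟨ sumTo-*ˡ n A (λ i → product (map (λ p → weight p 0 (+ i)) L)) ⟩
    A ℕ.* sumTo n (λ i → product (map (λ p → weight p 0 (+ i)) L))
      ≡⟨ cong (A ℕ.*_) (sumTo-product (λ p → weight p 0) (λ p → weight-periodic {p} {0})) ⟩
    A ℕ.* (c ℕ.* product (map (λ p → sumTo p (λ i → weight p 0 (+ i))) L))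
      ≡⟨ cong (λ z → A ℕ.* (c ℕ.* z)) (product-map-cong L
           (λ p p∈L → sumTo-weight-residues 0 {{prime⇒nonZero (All.lookup primes p∈L)}})) ⟩
    A ℕ.* (c ℕ.* product (map (λ p → α p 1) L))
      ≡⟨ regroup (c ^ k) (product (map (λ p → α p k) L)) c (product (map (λ p → α p 1) L)) ⟩
    c ^ suc k ℕ.* (product (map (λ p → α p 1) L) ℕ.* product (map (λ p → α p k) L))
      ≡⟨ cong (c ^ suc k ℕ.*_) (product-map-* (λ p → α p 1) (λ p → α p k) L) ⟨
    c ^ suc k ℕ.* product (map (λ p → α p 1 ℕ.* α p k) L) ∎
    where
    open ≡-Reasoning
    A : ℕ
    A = c ^ k ℕ.* product (map (λ p → α p k) L)
    regroup : ∀ a b c d → (a ℕ.* b) ℕ.* (c ℕ.* d) ≡ (c ℕ.* a) ℕ.* (d ℕ.* b)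
    regroup = ℕ-solver.solve-∀
    indicator-× : ∀ {P Q : Set} (P? : Dec P) (Q? : Dec Q) → indicator (P? ×-dec Q?) ≡ indicator P? ℕ.* indicator Q?
    indicator-× P? Q? with does P? | does Q?
    ... | true  | true  = refl
    ... | true  | false = refl
    ... | false | _     = refl
    U : Fin n → ℕ
    U e = indicator (unit? ⟦ e ⟧)
    fibre : ∀ e → sum (map (λ cs → indicator (valid? (e ∷ cs))) (allVecs k)) ≡
                  A ℕ.* product (map (λ p → weight p 0 ⟦ e ⟧) L)
    fibre e = begin
      sum (map (λ cs → indicator (valid? (e ∷ cs))) (allVecs k))
        ≡⟨ sum-map-cong (allVecs k) (λ cs → trans (indicator-× (unit? ⟦ e ⟧) (unit? (endpoint (+ 0) ⟦ e ⟧ cs)))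
             (cong (U e ℕ.*_) (indicator-unit (endpoint (+ 0) ⟦ e ⟧ cs)))) ⟩
      sum (map (λ cs → U e ℕ.* product (map (λ p → weight p 0 (endpoint (+ 0) ⟦ e ⟧ cs)) L)) (allVecs k))
        ≡⟨ sum-map-*ˡ (U e) (λ cs → product (map (λ p → weight p 0 (endpoint (+ 0) ⟦ e ⟧ cs)) L)) (allVecs k) ⟩
      U e ℕ.* sum (map (λ cs → product (map (λ p → weight p 0 (endpoint (+ 0) ⟦ e ⟧ cs)) L)) (allVecs k))
        ≡⟨ on-units ⟩
      U e ℕ.* A
        ≡⟨ ℕ.*-comm (U e) A ⟩
      A ℕ.* U e
        ≡⟨ cong (A ℕ.*_) (indicator-unit ⟦ e ⟧) ⟩
      A ℕ.* product (map (λ p → weight p 0 ⟦ e ⟧) L) ∎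
      where
      -- `sum-endpoint` requires (0, e) to be nonzero modulo every p, which holds for units e; for
      -- any other e the factor `U e` is 0.
      on-units : U e ℕ.* sum (map (λ cs → product (map (λ p → weight p 0 (endpoint (+ 0) ⟦ e ⟧ cs)) L)) (allVecs k))
               ≡ U e ℕ.* A
      on-units with unit? ⟦ e ⟧
      ... | no _  = refl
      ... | yes u = cong (ℕ._+ 0) (trans
        (sum-endpoint k (+ 0) ⟦ e ⟧ (λ p p∈L (_ , e≈0) → unit-coprime {p} {⟦ e ⟧} (All.lookup primes p∈L) p∈L u e≈0))
        (cong (c ^ k ℕ.*_) (product-map-cong L (λ p p∈L →
          weight-nonzero {p} {k} {⟦ e ⟧} (unit-coprime {p} {⟦ e ⟧} (All.lookup primes p∈L) p∈L u)))))

-- Valuations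

νaux-spec : ∀ f p n → 2 ℕ.≤ p → .{{NonZero n}} → n ℕ.≤ f →
            (p ^ νaux f p n ∣ n) × ¬ (p ^ suc (νaux f p n) ∣ n)
νaux-spec (suc f) p (suc n) 2≤p (s≤s n≤f) with p ∣? suc n
... | no p∤n = ∣.1∣ suc n , λ p¹∣n → p∤n (subst (_∣ suc n) (ℕ.*-identityʳ p) p¹∣n)
... | yes (divides zero ())
... | yes (divides (suc q) eq) with νaux-spec f p (suc q) 2≤p (ℕ.≤-pred (ℕ.≤-trans q<n (s≤s n≤f)))
  where
  q<n : suc q ℕ.< suc n
  q<n = subst (suc q ℕ.<_) (sym eq) (ℕ.m<m*n (suc q) p 2≤p)
... | pᵛ∣q , pᵛ⁺¹∤q =
    subst (p ^ suc v ∣_) (sym eq′) (∣.*-monoʳ-∣ p pᵛ∣q)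
  , λ d → pᵛ⁺¹∤q (∣.*-cancelˡ-∣ p {{ℕ.>-nonZero (ℕ.<⇒≤ 2≤p)}} (subst (p ^ suc (suc v) ∣_) eq′ d))
  where
  v : ℕ
  v = νaux f p (suc q)
  eq′ : suc n ≡ p ℕ.* suc q
  eq′ = trans eq (ℕ.*-comm (suc q) p)

prime-∣-^ : ∀ {q p} a → Prime q → q ∣ p ^ a → q ∣ p
prime-∣-^ zero    qp q∣1 = contradiction (∣.∣1⇒≡1 q∣1) (ℕ.nonTrivial⇒≢1 {{prime⇒nonTrivial qp}})
prime-∣-^ {q} {p} (suc a) qp q∣ with euclidsLemma p (p ^ a) qp q∣
... | inj₁ q∣p  = q∣p
... | inj₂ q∣pᵃ = prime-∣-^ a qp q∣pᵃ

prime-∣-prime : ∀ {q p} → Prime q → Prime p → q ∣ p → q ≡ p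
prime-∣-prime qp pp q∣p with prime⇒irreducible pp q∣p
... | inj₁ q≡1 = contradiction q≡1 (ℕ.nonTrivial⇒≢1 {{prime⇒nonTrivial qp}})
... | inj₂ q≡p = q≡p

prime-∣-product : ∀ {q} (f : ℕ → ℕ) L → Prime q → q ∣ product (map f L) → ∃ λ p → p ∈ L × q ∣ f p
prime-∣-product f []      qp q∣1 = contradiction (∣.∣1⇒≡1 q∣1) (ℕ.nonTrivial⇒≢1 {{prime⇒nonTrivial qp}})
prime-∣-product f (p ∷ L) qp q∣ with euclidsLemma (f p) (product (map f L)) qp q∣
... | inj₁ q∣fp = p , here refl , q∣fp
... | inj₂ q∣Π with prime-∣-product f L qp q∣Π
...   | r , r∈L , q∣fr = r , there r∈L , q∣fr

coprime-*-∣ : ∀ {m k n} → Coprime m k → m ∣ n → k ∣ n → m ℕ.* k ∣ n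
coprime-*-∣ {m} {k} c m∣n (divides q refl) = ∣.*-monoˡ-∣ k (coprime-divisor c (subst (m ∣_) (ℕ.*-comm q k) m∣n))

-- A common prime factor of powers of two primes would equal both, so powers of distinct primes are
-- coprime and their product divides n.
primePowers-∣ : ∀ {n} (a : ℕ → ℕ) {L} → All Prime L → Unique L → (∀ p → p ∈ L → p ^ a p ∣ n) →
                product (map (λ p → p ^ a p) L) ∣ n
primePowers-∣ {n} a []                       []                  div = ∣.1∣ n
primePowers-∣ {n} a {p ∷ L} (pp ∷ primes) (distinct ∷ unique) div =
  coprime-*-∣ cop (div p (here refl)) (primePowers-∣ a primes unique (λ q q∈L → div q (there q∈L)))
  where
  cop : Coprime (p ^ a p) (product (map (λ q → q ^ a q) L))
  cop {zero} (0∣pᵃ , _) = contradiction (∣.0∣⇒≡0 0∣pᵃ) (ℕ.≢-nonZero⁻¹ _ {{ℕ.m^n≢0 p (a p) {{prime⇒nonZero pp}}}})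
  cop {suc zero} _ = refl
  cop {suc (suc d)} (d∣pᵃ , d∣Π) with ∃-prime-divisor (suc (suc d)) (λ ())
  ... | r , rp , r∣d with prime-∣-product (λ q → q ^ a q) L rp (∣.∣-trans r∣d d∣Π)
  ...   | q , q∈L , r∣qᵃ = contradiction
          (trans (sym (prime-∣-prime rp pp (prime-∣-^ (a p) rp (∣.∣-trans r∣d d∣pᵃ))))
                 (prime-∣-prime rp (All.lookup primes q∈L) (prime-∣-^ (a q) rp r∣qᵃ)))
          (All.lookup distinct q∈L)

module Valuation (n : ℕ) .{{n≢0 : NonZero n}} where

  L : List ℕ
  L = primeDivisors n

  private
    isPrimeDivisor? : Decidable (λ p → Prime p × (p ∣ n))
    isPrimeDivisor? p = prime? p ×-dec (p ∣? n)

  L-sound : ∀ {p} → p ∈ L → Prime p × (p ∣ n)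
  L-sound p∈L = proj₂ (∈-filter⁻ isPrimeDivisor? {xs = List.upTo (suc n)} p∈L)

  L-complete : ∀ {p} → Prime p → p ∣ n → p ∈ L
  L-complete pp p∣n = ∈-filter⁺ isPrimeDivisor? (∈-upTo⁺ (s≤s (∣⇒≤ p∣n))) (pp , p∣n)

  primes : All Prime L
  primes = All.tabulate (λ p∈L → proj₁ (L-sound p∈L))

  unique : Unique L
  unique = Unique.filter⁺ isPrimeDivisor? (Unique.upTo⁺ (suc n))

  ν-spec : ∀ p → p ∈ L → (p ^ ν p n ∣ n) × ¬ (p ^ suc (ν p n) ∣ n)
  ν-spec p p∈L = νaux-spec n p n (ℕ.nonTrivial⇒n>1 p {{prime⇒nonTrivial (proj₁ (L-sound p∈L))}}) ℕ.≤-refl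

  -- The product of the prime powers divides n; a prime r dividing the quotient would make r ^ (ν r
  -- n + 1) divide n.
  factorisation : n ≡ product (map (λ p → p ^ ν p n) L)
  factorisation with primePowers-∣ (λ p → ν p n) primes unique (λ p p∈L → proj₁ (ν-spec p p∈L))
  ... | divides zero eq       = contradiction eq (ℕ.≢-nonZero⁻¹ n)
  ... | divides (suc zero) eq = trans eq (ℕ.*-identityˡ _)
  ... | divides Q@(suc (suc _)) eq with ∃-prime-divisor Q (λ ())
  ...   | r , rp , r∣Q = contradiction
          (subst (r ^ suc (ν r n) ∣_) (sym eq) (∣.*-pres-∣ r∣Q (∈⇒∣product (∈-map⁺ (λ p → p ^ ν p n) r∈L))))
          (proj₂ (ν-spec r r∈L))
    where
    r∈L : r ∈ L
    r∈L = L-complete rp (subst (r ∣_) (sym eq) (∣.∣m⇒∣m*n (product (map (λ p → p ^ ν p n) L)) r∣Q))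

  cofactor : ℕ
  cofactor = product (map (λ p → p ^ (ν p n ∸ 1)) L)

  n≡cofactor*ΠL : n ≡ cofactor ℕ.* product L
  n≡cofactor*ΠL = trans factorisation (trans (product-map-cong L peel)
    (trans (product-map-* (λ p → p ^ (ν p n ∸ 1)) Function.id L)
      (cong (λ M → cofactor ℕ.* product M) (List.map-id L))))
    where
    peel : ∀ p → p ∈ L → p ^ ν p n ≡ p ^ (ν p n ∸ 1) ℕ.* p
    peel p p∈L with ν p n | ν-spec p p∈L
    ... | zero  | _ , p¹∤n = contradiction (subst (_∣ n) (sym (ℕ.*-identityʳ p)) (proj₂ (L-sound p∈L))) p¹∤n
    ... | suc v | _        = ℕ.*-comm p (p ^ v)

-- Closed form of the count

pos-^ : ∀ p e → + (p ^ e) ≡ (+ p) ℤ.^ e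
pos-^ p zero    = refl
pos-^ p (suc e) = trans (ℤ.pos-* p (p ^ e)) (cong (+ p *_) (pos-^ p e))

-- The step (α, β) ↦ (β + (p - 1) α, p α) has eigenvalues p and -1, so both sequences combine their
-- powers over the denominator p + 1, cleared here. The prime is written `suc p` so that the
-- truncated p ∸ 1 reduces.
α-closed : ∀ p k → + α (suc p) k * (+ suc p + + 1) ≡ (+ suc p) ℤ.^ suc k + (- + 1) ℤ.^ k
β-closed : ∀ p k → + β (suc p) k * (+ suc p + + 1) ≡ (+ suc p) ℤ.^ suc k - + suc p * (- + 1) ℤ.^ k
α-closed p zero    = base (+ suc p)
  where
  base : ∀ p → + 1 * (p + + 1) ≡ p * + 1 + + 1
  base = solve-∀
α-closed p (suc k) = trans
  (cong (λ z → (+ β (suc p) k + z) * (+ suc p + + 1)) (ℤ.pos-* p (α (suc p) k)))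
  (trans (distribute (+ β (suc p) k) (+ α (suc p) k) (+ p))
    (trans (cong₂ (λ v w → v + + p * w) (β-closed p k) (α-closed p k))
      (collect (+ p) ((+ suc p) ℤ.^ k) ((- + 1) ℤ.^ k))))
  where
  distribute : ∀ b a p → (b + p * a) * (+ 1 + p + + 1) ≡ b * (+ 1 + p + + 1) + p * (a * (+ 1 + p + + 1))
  distribute = solve-∀
  collect : ∀ p P s → ((+ 1 + p) * P - (+ 1 + p) * s) + p * ((+ 1 + p) * P + s)
                    ≡ (+ 1 + p) * ((+ 1 + p) * P) + (- + 1) * s
  collect = solve-∀
β-closed p zero    = sym (cancel (+ suc p))
  where
  cancel : ∀ p → p * + 1 - p * + 1 ≡ + 0
  cancel = solve-∀
β-closed p (suc k) = trans (cong (_* (+ suc p + + 1)) (ℤ.pos-* (suc p) (α (suc p) k)))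
  (trans (ℤ.*-assoc (+ suc p) (+ α (suc p) k) (+ suc p + + 1))
    (trans (cong (+ suc p *_) (α-closed p k)) (collect (+ suc p) ((+ suc p) ℤ.^ suc k) ((- + 1) ℤ.^ k))))
  where
  collect : ∀ p P s → p * (P + s) ≡ p * P - p * ((- + 1) * s)
  collect = solve-∀

-- The width is m = k + 2, so the exponent m - 1 is k + 1 and the sign (-1)^m equals the (-1)^k of
-- `α-closed`; the factor p - 1 is α p 1.
local-factor : ∀ n k p → .{{NonZero p}} →
  + ((p ^ (ν p n ∸ 1)) ^ suc k ℕ.* (α p 1 ℕ.* α p k)) * denFactor p ≡ numFactor n (2 ℕ.+ k) p
local-factor n k (suc p) = trans
  (cong (_* denFactor (suc p)) (trans (ℤ.pos-* ((suc p ^ a) ^ suc k) (α (suc p) 1 ℕ.* α (suc p) k))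
    (cong₂ _*_ (trans (cong +_ (ℕ.^-*-assoc (suc p) a (suc k))) (pos-^ (suc p) (a ℕ.* suc k)))
               (trans (ℤ.pos-* (α (suc p) 1) (α (suc p) k))
                      (cong (λ z → + z * + α (suc p) k) (ℕ.*-identityʳ p))))))
  (trans (regroup Q (+ p) (+ α (suc p) k) (denFactor (suc p)))
    (trans (cong (λ z → Q * + p * z) (α-closed p k))
      (finish Q (+ p) ((+ suc p) ℤ.^ suc k) ((- + 1) ℤ.^ k))))
  where
  a : ℕ
  a = ν (suc p) n ∸ 1
  Q : ℤ
  Q = (+ suc p) ℤ.^ (a ℕ.* suc k)
  regroup : ∀ Q p A d → Q * (p * A) * d ≡ Q * p * (A * d)
  regroup = solve-∀
  finish : ∀ Q p P s → Q * p * (P + s) ≡ Q * (P + (- + 1) * ((- + 1) * s)) * (+ 1 + p - + 1)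
  finish = solve-∀

product-map-^ : ∀ (f : ℕ → ℕ) L j → product (map f L) ^ j ≡ product (map (λ p → f p ^ j) L)
product-map-^ f L zero    = sym (product-map-1 L)
product-map-^ f L (suc j) = trans (cong (product (map f L) ℕ.*_) (product-map-^ f L j))
  (sym (product-map-* f (λ p → f p ^ j) L))

prodℤ-fractions : ∀ (f : ℕ → ℕ) (d e : ℕ → ℤ) L → (∀ p → p ∈ L → + f p * d p ≡ e p) →
                  + product (map f L) * prodℤ (map d L) ≡ prodℤ (map e L)
prodℤ-fractions f d e []      eq = refl
prodℤ-fractions f d e (p ∷ L) eq = trans
  (cong (_* (d p * prodℤ (map d L))) (ℤ.pos-* (f p) (product (map f L))))
  (trans (interchange (+ f p) (+ product (map f L)) (d p) (prodℤ (map d L)))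
    (cong₂ _*_ (eq p (here refl)) (prodℤ-fractions f d e L (λ q q∈L → eq q (there q∈L)))))
  where
  interchange : ∀ a b c d → (a * b) * (c * d) ≡ (a * c) * (b * d)
  interchange = solve-∀

theoremA : (n m : ℕ) → 2 ≤ n → 2 ≤ m →
    Σ ℕ (λ N → HasCardinality (TameFrieze n m) _≈F_ N
      × (+ N * prodℤ (map denFactor (primeDivisors n))
          ≡ prodℤ (map (numFactor n m) (primeDivisors n))))
theoremA n (suc zero) 2≤n (s≤s ())
theoremA n (suc (suc k)) 2≤n 2≤m = length (validVecs k) , friezes-counted k , (begin
  + length (validVecs k) * prodℤ (map denFactor L)
    ≡⟨ cong (λ N → + N * prodℤ (map denFactor L)) (length-validVecs k) ⟩
  + (cofactor ^ suc k ℕ.* product (map (λ p → α p 1 ℕ.* α p k) L)) * prodℤ (map denFactor L)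
    ≡⟨ cong (λ z → + (z ℕ.* product (map (λ p → α p 1 ℕ.* α p k) L)) * prodℤ (map denFactor L))
         (product-map-^ (λ p → p ^ (ν p n ∸ 1)) L (suc k)) ⟩
  + (product (map (λ p → (p ^ (ν p n ∸ 1)) ^ suc k) L) ℕ.* product (map (λ p → α p 1 ℕ.* α p k) L))
      * prodℤ (map denFactor L)
    ≡⟨ cong (λ N → + N * prodℤ (map denFactor L))
         (product-map-* (λ p → (p ^ (ν p n ∸ 1)) ^ suc k) (λ p → α p 1 ℕ.* α p k) L) ⟨
  + product (map (λ p → (p ^ (ν p n ∸ 1)) ^ suc k ℕ.* (α p 1 ℕ.* α p k)) L) * prodℤ (map denFactor L)
    ≡⟨ prodℤ-fractions _ denFactor (numFactor n (2 ℕ.+ k)) L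
         (λ p p∈L → local-factor n k p {{prime⇒nonZero (All.lookup primes p∈L)}}) ⟩
  prodℤ (map (numFactor n (2 ℕ.+ k)) L) ∎)
  where
  open ≡-Reasoning
  instance
    n≢0 : NonZero n
    n≢0 = ℕ.>-nonZero (ℕ.<⇒≤ 2≤n)
  open Quiddity n
  open Valuation n
  open Counting n cofactor L primes unique L-complete n≡cofactor*ΠL using (length-validVecs)
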